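{- There is a polynomial $p$ such that for any two shape expression schemas $H$ and $K$ with $L(H)\not\subseteq L(K)$, there exists a compressed graph $\mathcal F$ that satisfies $H$, does not satisfy $K$, and whose size (with cardinalities written in binary) is at most $2^{2^{p(|H|+|K|)}}$.
   Context: Fix a finite set $\Sigma$ of edge labels. An interval $[n;m]$ with $n\in\mathbb N$, $m\in\mathbb N\cup\{\infty\}$, $n\le m$, denotes $\{i\in\mathbb N: n\le i\le m\}$, bounds stored in binary. Regular bag expressions (RBE) over a finite alphabet $\Delta$: $E::=\epsilon\mid a\mid (E\mid E)\mid (E\,\|\,E)\mid E^I$ with $a\in\Delta$ and $I$ an arbitrary interval; semantics (sets of bags): $L(\epsilon)=\{\text{empty bag}\}$, $L(a)=\{\{\!|a|\!\}\}$, $L(E_1\mid E_2)=L(E_1)\cup L(E_2)$, $L(E_1\|E_2)=\{w_1\uplus w_2: w_i\in L(E_i)\}$ ($\uplus$ is bag union), $L(E^I)=\bigcup_{i\in I}L(E)^i$ with $L^0=\{\text{empty bag}\}$, $L^i=L\uplus L^{i-1}$. A shape expression schema is $S=(\Gamma_S,\delta_S)$ with $\Gamma_S$ a finite set of types and $\delta_S$ mapping each type to an RBE over $\Sigma\times\Gamma_S$ (elements written $a::t$); its size $|S|$ is the length of its description. A simple graph is $G=(N,E,\mathsf{source},\mathsf{target},\mathsf{lab})$ with finite node and edge sets, $\mathsf{source},\mathsf{target}:E\to N$, $\mathsf{lab}:E\to\Sigma$, no two distinct edges having the same source, target and label; each edge is regarded as carrying interval $[1;1]$. A compressed graph is the same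 except each edge $e$ carries a singleton interval $\mathsf{occur}(e)=[k;k]$ ($k\in\mathbb N$ in binary). For either kind of graph, a typing is $T\subseteq N\times\Gamma_S$; the signature of $n$ w.r.t. $T$ is the RBE $\|_{e\in\mathsf{out}(n)}\big(|_{t\in T(\mathsf{target}(e))}\mathsf{lab}(e)::t\big)^{\mathsf{occur}(e)}$, where $\mathsf{out}(n)$ is the set of edges with source $n$. $T$ is valid if $L(\mathrm{sign}^T(n))\cap L(\delta_S(t))\neq\emptyset$ for every $(n,t)\in T$. There is a unique maximal valid typing, and the graph satisfies $S$ if every node is assigned at least one type by it. $L(S)$ is the set of simple graphs satisfying $S$. -}

module Defs where

open import Data.Nat using (ℕ; zero; suc; _+_; _≤_)
open import Data.Nat.Logarithm using (⌊log₂_⌋)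
open import Data.Fin using (Fin)
open import Data.Fin.Properties using () renaming (_≟_ to _≟ᶠ_)
open import Data.List using (List; []; _∷_; foldr; filter; map)
open import Data.Nat.ListAction using (sum)
open import Data.List.Base using (allFin)
open import Data.Product using (Σ; ∃; ∃-syntax; _×_; _,_)
open import Data.Product.Properties using (≡-dec)
open import Data.Sum using (_⊎_)
open import Data.Empty using (⊥)
open import Data.Bool using (Bool; true; false; if_then_else_; T)
open import Relation.Nullary.Decidable using (does)
open import Relation.Binary.PropositionalEquality using (_≡_)

Sym : ℕ → ℕ → Set
Sym nΣ nΓ = Fin nΣ × Fin nΓ

Bag : ℕ → ℕ → Set
Bag nΣ nΓ = Sym nΣ nΓ → ℕ

Lang : ℕ → ℕ → Set₁
Lang nΣ nΓ = Bag nΣ nΓ → Set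

module _ {nΣ nΓ : ℕ} where

  emptyBagL : Lang nΣ nΓ
  emptyBagL w = ∀ x → w x ≡ 0

  singleL : Sym nΣ nΓ → Lang nΣ nΓ
  singleL a w = ∀ x → w x ≡ (if does (≡-dec _≟ᶠ_ _≟ᶠ_ x a) then 1 else 0)

  noneL : Lang nΣ nΓ
  noneL _ = ⊥

  _∪L_ : Lang nΣ nΓ → Lang nΣ nΓ → Lang nΣ nΓ
  (L₁ ∪L L₂) w = L₁ w ⊎ L₂ w

  _⊎L_ : Lang nΣ nΓ → Lang nΣ nΓ → Lang nΣ nΓ
  (L₁ ⊎L L₂) w = Σ (Bag nΣ nΓ) λ w₁ → Σ (Bag nΣ nΓ) λ w₂ →
                   L₁ w₁ × L₂ w₂ × (∀ x → w x ≡ w₁ x + w₂ x)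

  powL : Lang nΣ nΓ → ℕ → Lang nΣ nΓ
  powL L zero    = emptyBagL
  powL L (suc i) = L ⊎L powL L i

data Bound : Set where
  fin : ℕ → Bound
  ∞   : Bound

_≤B_ : ℕ → Bound → Set
n ≤B fin m = n ≤ m
n ≤B ∞     = Data.Bool.T true

record Interval : Set where
  constructor mkInterval
  field
    lo  : ℕ
    hi  : Bound
    ok  : lo ≤B hi

_∈I_ : ℕ → Interval → Set
i ∈I I = Interval.lo I ≤ i × i ≤B Interval.hi I

data RBE (nΣ nΓ : ℕ) : Set where
  ε    : RBE nΣ nΓ
  sym  : Sym nΣ nΓ → RBE nΣ nΓ
  _∣_  : RBE nΣ nΓ → RBE nΣ nΓ → RBE nΣ nΓ
  _∥_  : RBE nΣ nΓ → RBE nΣ nΓ → RBE nΣ nΓ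
  _^ᴵ_ : RBE nΣ nΓ → Interval → RBE nΣ nΓ

⟦_⟧ : ∀ {nΣ nΓ} → RBE nΣ nΓ → Lang nΣ nΓ
⟦ ε ⟧       = emptyBagL
⟦ sym a ⟧   = singleL a
⟦ E ∣ F ⟧   = ⟦ E ⟧ ∪L ⟦ F ⟧
⟦ E ∥ F ⟧   = ⟦ E ⟧ ⊎L ⟦ F ⟧
⟦ E ^ᴵ I ⟧ w = ∃[ i ] (i ∈I I × powL ⟦ E ⟧ i w)

bits : ℕ → ℕ
bits n = suc ⌊log₂ n ⌋

sizeB : Bound → ℕ
sizeB (fin m) = bits m
sizeB ∞       = 1

sizeI : Interval → ℕ
sizeI I = suc (bits (Interval.lo I) + sizeB (Interval.hi I))

sizeE : ∀ {nΣ nΓ} → RBE nΣ nΓ → ℕ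
sizeE ε       = 1
sizeE (sym _) = 1
sizeE (E ∣ F) = suc (sizeE E + sizeE F)
sizeE (E ∥ F) = suc (sizeE E + sizeE F)
sizeE (E ^ᴵ I) = suc (sizeE E + sizeI I)

record Schema (nΣ : ℕ) : Set where
  field
    nT : ℕ
    δ  : Fin nT → RBE nΣ nT

sizeS : ∀ {nΣ} → Schema nΣ → ℕ
sizeS S = Schema.nT S + sum (map (λ t → sizeE (Schema.δ S t)) (allFin (Schema.nT S)))

-- Compressed graphs (each edge carries occur(e) = [k;k]) and simple graphs

record CGraph (nΣ : ℕ) : Set where
  field
    nN nE  : ℕ
    source : Fin nE → Fin nN
    target : Fin nE → Fin nN
    lab    : Fin nE → Fin nΣ
    occur  : Fin nE → ℕ
    simple : ∀ e e' → source e ≡ source e' → target e ≡ target e' →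
             lab e ≡ lab e' → e ≡ e'

record SGraph (nΣ : ℕ) : Set where
  field
    nN nE  : ℕ
    source : Fin nE → Fin nN
    target : Fin nE → Fin nN
    lab    : Fin nE → Fin nΣ
    simple : ∀ e e' → source e ≡ source e' → target e ≡ target e' →
             lab e ≡ lab e' → e ≡ e'

toCGraph : ∀ {nΣ} → SGraph nΣ → CGraph nΣ
toCGraph G = record
  { nN = SGraph.nN G ; nE = SGraph.nE G
  ; source = SGraph.source G ; target = SGraph.target G ; lab = SGraph.lab G
  ; occur = λ _ → 1 ; simple = SGraph.simple G }

sizeG : ∀ {nΣ} → CGraph nΣ → ℕ
sizeG G = CGraph.nN G + sum (map (λ e → suc (bits (CGraph.occur G e))) (allFin (CGraph.nE G)))

module _ {nΣ : ℕ} (S : Schema nΣ) (G : CGraph nΣ) where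
  open Schema S
  open CGraph G

  Typing : Set
  Typing = Fin nN → Fin nT → Bool

  disjL : List (Sym nΣ nT) → Lang nΣ nT
  disjL = foldr (λ a L → singleL a ∪L L) noneL

  shuffleL : List (Lang nΣ nT) → Lang nΣ nT
  shuffleL = foldr _⊎L_ emptyBagL

  out : Fin nN → List (Fin nE)
  out n = filter (λ e → source e ≟ᶠ n) (allFin nE)

  typesOf : Typing → Fin nN → List (Fin nT)
  typesOf Ty m = filter (λ t → Ty m t Data.Bool.≟ true) (allFin nT)

  -- L(sign^T(n)) = L( ‖_{e ∈ out n} ( |_{t ∈ T(target e)} lab(e)::t )^[occur e ; occur e] )
  signL : Typing → Fin nN → Lang nΣ nT
  signL Ty n = shuffleL (map (λ e → powL (disjL (map (λ t → (lab e , t)) (typesOf Ty (target e)))) (occur e)) (out n))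

  Valid : Typing → Set
  Valid Ty = ∀ n t → Ty n t ≡ true →
             Σ (Bag nΣ nT) λ w → signL Ty n w × ⟦ δ t ⟧ w

  MaxValid : Typing → Set
  MaxValid Ty = Valid Ty × (∀ Ty' → Valid Ty' → ∀ n t → Ty' n t ≡ true → Ty n t ≡ true)

  Satisfies : Set
  Satisfies = Σ Typing λ Ty → MaxValid Ty × (∀ n → ∃[ t ] (Ty n t ≡ true))

_∈L_ : ∀ {nΣ} → SGraph nΣ → Schema nΣ → Set
G ∈L S = Satisfies S (toCGraph G)

evalPoly : List ℕ → ℕ → ℕ
evalPoly []       x = 0
evalPoly (c ∷ cs) x = c + x Data.Nat.* evalPoly cs x

{-# OPTIONS --safe #-}

-- Let G satisfy H but not K, and refine the typing of G with respect to K in stages, starting from all types. The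
-- kind of a node at a stage consists of its H-types and of the K-types that survive at that stage. Taking one node
-- per kind, whose edges imitate those of a node of G with that kind at the earliest possible stage and lead to the
-- kinds of the targets one stage before, gives a compressed graph with exponentially many nodes; it satisfies H,
-- and by induction on stages its K-types are among those recorded in the kinds, so it violates K.
--
-- It remains to bound the multiplicities of the edges of a node, which only matter through the set of the types t
-- for which some choice of types for the edges gives a bag in L(δ t). The language of an expression is a union of
-- sets b + P where b is at most exponential and P ranges over exponentially many monoids; every p ∈ P has the form
-- 2 p' + e with p', e ∈ P and e at most exponential. Hence a vector of multiplicities can be processed digit by
-- digit, and the set of the exponentially many residual conditions that it meets acts as the state of a finite
-- automaton. If the vector has more digits than there are such sets, some state repeats and the digits in between
-- can be removed, so doubly exponentially many digits suffice.
module Submission where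

open import Defs
open import Data.Bool using (Bool; true; false; if_then_else_; _∨_)
open import Data.Nat.Logarithm using (⌊log₂⌋-mono-≤; ⌊log₂[2^n]⌋≡n)
import Data.Bool as Bool
open import Data.Bool.Properties using (¬-not)
open import Data.List.Membership.Propositional using (_∈_)
open import Data.List.Membership.Propositional.Properties using (∈-filter⁺; ∈-filter⁻; ∈-allFin)
open import Data.List.Relation.Unary.Any using (here; there)
open import Data.Empty using (⊥-elim)
open import Data.Fin using (Fin; zero; suc; toℕ; fromℕ<; combine; remQuot; funToFin; finToFun; punchIn; punchOut; inject≤; splitAt; _↑ˡ_; _↑ʳ_)
open import Data.Fin.Properties using (any?; all?; toℕ<n; toℕ-fromℕ<; remQuot-combine; combine-remQuot; finToFun-funToFin; pigeonhole; punchIn-punchOut; toℕ-inject≤; toℕ-injective; splitAt-↑ˡ; splitAt-↑ʳ; ¬∀⟶∃¬) renaming (suc-injective to suc-injectiveᶠ; _≟_ to _≟ᶠ_)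
open import Data.List using (List; []; _∷_; map; filter; foldr; tabulate; allFin; length)
open import Data.List.Properties using (length-tabulate)
open import Data.Nat.ListAction using () renaming (sum to List-sum)
open import Data.Nat
open import Data.Nat.Properties
open import Data.Nat.DivMod using (m≡m%n+[m/n]*n; [m+kn]%n≡m%n; +-distrib-/-∣ˡ)
open import Data.Nat.Divisibility using (divides)
open import Data.Nat.Induction using (<-wellFounded)
open import Data.Nat.Tactic.RingSolver using (solve-∀)
open import Data.Product using (Σ; ∃; ∃₂; _×_; _,_; proj₁; proj₂)
open import Data.Product.Properties using (≡-dec)
open import Data.Sum using (_⊎_; inj₁; inj₂; [_,_])
open import Data.Unit using (⊤; tt)
open import Function using (_∘_)
open import Relation.Binary.PropositionalEquality hiding ([_]) renaming (sym to ≡-sym)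
open import Relation.Nullary using (¬_; Dec; yes; no; does)
open import Relation.Nullary.Decidable using (map′; _×-dec_; _⊎-dec_; _→-dec_; dec-true; ¬¬-excluded-middle; decidable-stable)
open import Induction.WellFounded using (Acc) renaming (acc to wf)
open import Algebra.Properties.CommutativeMonoid.Sum +-0-commutativeMonoid using (sum; sum-remove; sum-cong-≗; ∑-distrib-+)
open import Algebra.Properties.CommutativeSemigroup +-commutativeSemigroup using (interchange; x∙yz≈y∙xz)

-- Languages of bags

-- The schemas pull in opposite directions: when multiplicities are reduced, the types of `H` must
-- survive, and no type of `K` may be gained. A small solution of the linear constraints behind `H`
-- would secure only the former. The reduced vector therefore has to meet exactly the conditions
-- that the original one meets, for all types of both schemas at once. An automaton whose states are
-- sets of conditions provides this, and passing to sets is the source of the second exponential.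
--
-- The bound on `e` has a combinatorial origin: `P` is generated by exponentially many bags with
-- exponential entries, so in a long sum of generators all but boundedly many pair up with an equal
-- one, and the pairs form `2 p'`.
--
-- Earliest stages are chosen because a maximal typing is a greatest fixed point: types may support
-- one another around a cycle, and fusing nodes creates cycles. Edges that lead to kinds acquired
-- strictly earlier, down to stage 0 where every type of `K` is allowed, make the argument about `K`
-- well-founded. For `H` no such care is needed, as any valid typing is a witness.

term≤sum : ∀ {n} (f : Fin n → ℕ) i → f i ≤ sum f
term≤sum f zero    = m≤m+n _ _
term≤sum f (suc i) = ≤-trans (term≤sum (f ∘ suc) i) (m≤n+m _ _)

sum-mono : ∀ {n} {f g : Fin n → ℕ} → (∀ i → f i ≤ g i) → sum f ≤ sum g
sum-mono {zero}  h = z≤n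
sum-mono {suc n} h = +-mono-≤ (h zero) (sum-mono (h ∘ suc))

sum-mono-< : ∀ {n} {f g : Fin n → ℕ} → (∀ i → f i ≤ g i) → ∀ i → f i < g i → sum f < sum g
sum-mono-< h zero    lt = +-mono-<-≤ lt (sum-mono (h ∘ suc))
sum-mono-< h (suc i) lt = +-mono-≤-< (h zero) (sum-mono-< (h ∘ suc) i lt)

sum-zero : ∀ {n} {f : Fin n → ℕ} → (∀ i → f i ≡ 0) → sum f ≡ 0
sum-zero {zero}  h = refl
sum-zero {suc n} h = cong₂ _+_ (h zero) (sum-zero (h ∘ suc))

bounded-∃? : ∀ {P : ℕ → Set} → (∀ i → Dec (P i)) → ∀ k → Dec (∃ λ i → i ≤ k × P i)
bounded-∃? {P} P? k = map′
  (λ { (i , p) → toℕ i , ≤-pred (toℕ<n i) , p })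
  (λ { (i , i≤k , p) → fromℕ< (s≤s i≤k) , subst P (≡-sym (toℕ-fromℕ< (s≤s i≤k))) p })
  (any? (λ i → P? (toℕ i)))

module _ {a b : ℕ} where

  infixl 6 _⊕_
  infix 4 _⊆_

  _⊕_ : Bag a b → Bag a b → Bag a b
  (w ⊕ v) x = w x + v x

  𝟘 : Bag a b
  𝟘 _ = 0

  twice_plus_ : Bag a b → Bag a b → Bag a b
  (twice w plus v) x = 2 * w x + v x

  _⊆_ : Lang a b → Lang a b → Set
  L ⊆ M = ∀ {w} → L w → M w

  Ext : Lang a b → Set
  Ext L = ∀ {w v} → w ≗ v → L w → L v

  DecL : Lang a b → Set
  DecL L = ∀ w → Dec (L w)

  BoundedBy : ℕ → Lang a b → Set
  BoundedBy k L = ∀ {w} → L w → ∀ x → w x ≤ k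

  total : Bag a b → ℕ
  total w = sum (λ j → w (remQuot {a} b j))

  ≤total : ∀ w x → w x ≤ total w
  ≤total w (p , q) = subst (λ y → w y ≤ total w) (remQuot-combine p q) (term≤sum _ (combine p q))

  total-⊕ : ∀ {w u v} → w ≗ u ⊕ v → total w ≡ total u + total v
  total-⊕ {w} {u} {v} e = trans (sum-cong-≗ (λ j → e (remQuot {a} b j))) (∑-distrib-+ (u ∘ remQuot {a} b) (v ∘ remQuot {a} b))

  ∀Sym? : ∀ {P : Sym a b → Set} → (∀ x → Dec (P x)) → Dec (∀ x → P x)
  ∀Sym? P? = map′ (λ h x → h (proj₁ x) (proj₂ x)) (λ h p q → h (p , q)) (all? (λ p → all? (λ q → P? (p , q))))

  -- The code serves two purposes: exhaustive search over the bags with entries at most `k`, and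
  -- counting them, both as generators of periods and as components of the states of the automaton.
  BagCode : ℕ → ℕ
  BagCode k = suc k ^ (a * b)

  bagOf : ∀ k → Fin (BagCode k) → Bag a b
  bagOf k i (p , q) = toℕ (finToFun {suc k} {a * b} i (combine p q))

  bagOf≤ : ∀ k i x → bagOf k i x ≤ k
  bagOf≤ k i (p , q) = ≤-pred (toℕ<n (finToFun {suc k} {a * b} i (combine p q)))

  codeOf : ∀ k (w : Bag a b) → (∀ x → w x ≤ k) → Fin (BagCode k)
  codeOf k w h = funToFin {a * b} (λ j → fromℕ< {w (remQuot {a} b j)} (s≤s (h (remQuot {a} b j))))

  bagOf-codeOf : ∀ k (w : Bag a b) (h : ∀ x → w x ≤ k) → bagOf k (codeOf k w h) ≗ w
  bagOf-codeOf k w h (p , q) = begin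
    toℕ (finToFun {suc k} {a * b} (codeOf k w h) (combine p q))
      ≡⟨ cong toℕ (finToFun-funToFin {a * b} (λ j → fromℕ< {w (remQuot {a} b j)} (s≤s (h (remQuot {a} b j)))) (combine p q)) ⟩
    toℕ (fromℕ< {w (remQuot {a} b (combine p q))} (s≤s (h (remQuot {a} b (combine p q)))))
      ≡⟨ toℕ-fromℕ< (s≤s (h (remQuot {a} b (combine p q)))) ⟩
    w (remQuot {a} b (combine p q))
      ≡⟨ cong w (remQuot-combine p q) ⟩
    w (p , q) ∎
    where open ≡-Reasoning

  bounded-∃Bag? : ∀ {P : Lang a b} → Ext P → DecL P → ∀ k → Dec (∃ λ w → (∀ x → w x ≤ k) × P w)
  bounded-∃Bag? {P} ext P? k = map′
    (λ { (i , p) → bagOf k i , bagOf≤ k i , p })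
    (λ { (w , h , p) → codeOf k w h , ext (λ x → ≡-sym (bagOf-codeOf k w h x)) p })
    (any? (λ i → P? (bagOf k i)))

  empty-ext : Ext emptyBagL
  empty-ext e h x = trans (≡-sym (e x)) (h x)

  single-ext : ∀ s → Ext (singleL s)
  single-ext s e h x = trans (≡-sym (e x)) (h x)

  ∪-ext : ∀ {L M} → Ext L → Ext M → Ext (L ∪L M)
  ∪-ext eL eM e (inj₁ p) = inj₁ (eL e p)
  ∪-ext eL eM e (inj₂ p) = inj₂ (eM e p)

  ⊎-ext : ∀ L M → Ext (L ⊎L M)
  ⊎-ext L M e (u , v , p , q , h) = u , v , p , q , λ x → trans (≡-sym (e x)) (h x)

  pow-ext : ∀ L i → Ext (powL L i)
  pow-ext L zero    = empty-ext
  pow-ext L (suc i) = ⊎-ext L (powL L i)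

  ⊎-intro : ∀ {L M : Lang a b} {u v} → L u → M v → (L ⊎L M) (u ⊕ v)
  ⊎-intro p q = _ , _ , p , q , λ _ → refl

  ⊎-mono : ∀ {L L' M M' : Lang a b} → L ⊆ L' → M ⊆ M' → (L ⊎L M) ⊆ (L' ⊎L M')
  ⊎-mono f g (u , v , p , q , h) = u , v , f p , g q , h

  pow-mono : ∀ {L M} → L ⊆ M → ∀ i → powL L i ⊆ powL M i
  pow-mono f zero    p = p
  pow-mono {L} {M} f (suc i) p = ⊎-mono {L} {M} {powL L i} {powL M i} f (pow-mono f i) p

  pow-add : ∀ L i j {u v} → powL L i u → powL L j v → powL L (i + j) (u ⊕ v)
  pow-add L zero    j {u} {v} p q = pow-ext L j (λ x → cong (_+ v x) (≡-sym (p x))) q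
  pow-add L (suc i) j {u} {v} (s , t , p , p' , h) q =
    s , t ⊕ v , p , pow-add L i j p' q , λ x → trans (cong (_+ v x) (h x)) (+-assoc (s x) (t x) (v x))

  pow-split : ∀ L i j {w} → powL L (i + j) w → (powL L i ⊎L powL L j) w
  pow-split L zero    j {w} p = 𝟘 , w , (λ _ → refl) , p , λ _ → refl
  pow-split L (suc i) j {w} (s , t , p , q , h) with pow-split L i j q
  ... | u , v , p' , q' , h' = s ⊕ u , v , (s , u , p , p' , λ _ → refl) , q' ,
        λ x → trans (h x) (trans (cong (s x +_) (h' x)) (≡-sym (+-assoc (s x) (u x) (v x))))

  pow-bounded : ∀ {L k} → BoundedBy k L → ∀ i → BoundedBy (i * k) (powL L i)
  pow-bounded bd zero    p x = ≤-reflexive (p x)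
  pow-bounded bd (suc i) (u , v , p , q , h) x =
    ≤-trans (≤-reflexive (h x)) (+-mono-≤ (bd p x) (pow-bounded bd i q x))

  -- Among more elements than the total number of symbols, one is the empty bag.
  pow-drop : ∀ L i {w} → total w < suc i → powL L (suc i) w → powL L i w
  pow-drop L i {w} lt (u , v , p , q , h) with ∀Sym? (λ x → u x ≟ 0)
  ... | yes u≡0 = pow-ext L i (λ x → trans (cong (_+ v x) (≡-sym (u≡0 x))) (≡-sym (h x))) q
  ... | no u≢0 = shift i (≤-trans v<w (≤-pred lt)) q
    where
    v<w : total v < total w
    v<w with total u in eq
    ... | zero  = ⊥-elim (u≢0 (λ x → n≤0⇒n≡0 (subst (u x ≤_) eq (≤total u x))))
    ... | suc k = subst (total v <_) (≡-sym (trans (total-⊕ {w} {u} {v} h) (cong (_+ total v) eq))) (s≤s (m≤n+m _ k))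
    shift : ∀ i → total v < i → powL L i v → powL L i w
    shift (suc j) lt' q' = u , v , p , pow-drop L j lt' q' , h

  ⟦⟧-ext : ∀ (E : RBE a b) → Ext ⟦ E ⟧
  ⟦⟧-ext ε        = empty-ext
  ⟦⟧-ext (sym s)  = single-ext s
  ⟦⟧-ext (E ∣ F)  = ∪-ext (⟦⟧-ext E) (⟦⟧-ext F)
  ⟦⟧-ext (E ∥ F)  = ⊎-ext ⟦ E ⟧ ⟦ F ⟧
  ⟦⟧-ext (E ^ᴵ I) e (i , m , p) = i , m , pow-ext ⟦ E ⟧ i e p

  empty-dec : DecL emptyBagL
  empty-dec w = ∀Sym? (λ x → w x ≟ 0)

  single-dec : ∀ s → DecL (singleL s)
  single-dec s w = ∀Sym? (λ x → w x ≟ _)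

  ⊎L-dec : ∀ {L M} → Ext L → Ext M → DecL L → DecL M → DecL (L ⊎L M)
  ⊎L-dec {L} {M} eL eM L? M? w = map′
    (λ { (u , _ , u≤w , p , q) → u , (λ x → w x ∸ u x) , p , q , λ x → ≡-sym (m+[n∸m]≡n (u≤w x)) })
    (λ { (u , v , p , q , h) → u ,
         (λ x → ≤-trans (m≤m+n (u x) (v x)) (≤-trans (≤-reflexive (≡-sym (h x))) (≤total w x))) ,
         (λ x → ≤-trans (m≤m+n (u x) (v x)) (≤-reflexive (≡-sym (h x)))) , p ,
         eM (λ x → ≡-sym (trans (cong (_∸ u x) (h x)) (m+n∸m≡n (u x) (v x)))) q })
    (bounded-∃Bag?
      (λ e (u≤w , p , q) → (λ x → ≤-trans (≤-reflexive (≡-sym (e x))) (u≤w x)) , eL e p , eM (λ x → cong (w x ∸_) (e x)) q)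
      (λ u → ∀Sym? (λ x → u x ≤? w x) ×-dec L? u ×-dec M? (λ x → w x ∸ u x))
      (total w))

  pow-dec : ∀ {L} → Ext L → DecL L → ∀ i → DecL (powL L i)
  pow-dec eL L? zero    = empty-dec
  pow-dec {L} eL L? (suc i) = ⊎L-dec eL (pow-ext L i) L? (pow-dec eL L? i)

_≤B?_ : ∀ n B → Dec (n ≤B B)
n ≤B? fin m = n ≤? m
n ≤B? ∞     = yes tt

≤B-pred : ∀ {n} B → suc n ≤B B → n ≤B B
≤B-pred (fin m) h = ≤-trans (n≤1+n _) h
≤B-pred ∞       h = tt

module _ {a b : ℕ} where

  ⟦⟧-dec : ∀ (E : RBE a b) → DecL ⟦ E ⟧
  ⟦⟧-dec ε        = empty-dec
  ⟦⟧-dec (sym s)  = single-dec s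
  ⟦⟧-dec (E ∣ F) w = ⟦⟧-dec E w ⊎-dec ⟦⟧-dec F w
  ⟦⟧-dec (E ∥ F)  = ⊎L-dec (⟦⟧-ext E) (⟦⟧-ext F) (⟦⟧-dec E) (⟦⟧-dec F)
  ⟦⟧-dec (E ^ᴵ I) w = map′ (λ { (i , _ , p) → i , p }) (λ { (i , m , p) → reduce i m p })
    (bounded-∃? (λ i → ((lo ≤? i) ×-dec (i ≤B? hi)) ×-dec pow-dec (⟦⟧-ext E) (⟦⟧-dec E) i w) (lo + total w))
    where
    open Interval I
    -- Among more than `total w` factors one is empty, so an exponent beyond `lo + total w` can be
    -- lowered by one without falling below `lo`.
    reduce : ∀ i → i ∈I I → powL ⟦ E ⟧ i w → ∃ λ i → i ≤ lo + total w × i ∈I I × powL ⟦ E ⟧ i w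
    reduce i m p with i ≤? lo + total w
    reduce i m p | yes le = i , le , m , p
    reduce zero m p | no nle = ⊥-elim (nle z≤n)
    reduce (suc i) (l , h) p | no nle =
      reduce i (≤-trans (m≤m+n lo (total w)) (≤-pred (≰⇒> nle)) , ≤B-pred hi h)
        (pow-drop ⟦ E ⟧ i (≤-trans (s≤s (m≤n+m (total w) lo)) (≰⇒> nle)) p)

  -- Enough to decide by search whether `L` meets a decidable language. Signatures and flows are of
  -- this kind; the language of an expression is decidable but may have unbounded entries.
  record Finite (L : Lang a b) : Set where
    field
      ext     : Ext L
      dec     : DecL L
      height  : ℕ
      bounded : BoundedBy height L

  open Finite

  finite-∃? : ∀ {L M} → Finite L → Ext M → DecL M → Dec (∃ λ w → L w × M w)
  finite-∃? fL eM M? = map′ (λ { (w , _ , p) → w , p }) (λ { (w , p , q) → w , bounded fL p , p , q })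
    (bounded-∃Bag? (λ e (p , q) → ext fL e p , eM e q) (λ w → dec fL w ×-dec M? w) (height fL))

  empty-finite : Finite emptyBagL
  empty-finite = record { ext = empty-ext ; dec = empty-dec ; height = 0 ; bounded = λ p x → ≤-reflexive (p x) }

  single≤1 : ∀ (s : Sym a b) → BoundedBy 1 (singleL s)
  single≤1 s p x with does (≡-dec _≟ᶠ_ _≟ᶠ_ x s) | p x
  ... | true  | h = ≤-reflexive h
  ... | false | h = ≤-trans (≤-reflexive h) z≤n

  single-finite : ∀ (s : Sym a b) → Finite (singleL s)
  single-finite s = record { ext = single-ext s ; dec = single-dec s ; height = 1 ; bounded = single≤1 s }

  none-finite : Finite noneL
  none-finite = record { ext = λ _ () ; dec = λ _ → no (λ ()) ; height = 0 ; bounded = λ () }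

  ∪-finite : ∀ {L M} → Finite L → Finite M → Finite (L ∪L M)
  ∪-finite fL fM = record
    { ext = ∪-ext (ext fL) (ext fM) ; dec = λ w → dec fL w ⊎-dec dec fM w ; height = height fL + height fM
    ; bounded = λ { (inj₁ p) x → ≤-trans (bounded fL p x) (m≤m+n _ _) ; (inj₂ p) x → ≤-trans (bounded fM p x) (m≤n+m _ _) } }

  ⊎-finite : ∀ {L M} → Finite L → Finite M → Finite (L ⊎L M)
  ⊎-finite {L} {M} fL fM = record
    { ext = ⊎-ext L M ; dec = ⊎L-dec (ext fL) (ext fM) (dec fL) (dec fM) ; height = height fL + height fM
    ; bounded = λ { (u , v , p , q , h) x → ≤-trans (≤-reflexive (h x)) (+-mono-≤ (bounded fL p x) (bounded fM q x)) } }

  pow-finite : ∀ {L} → Finite L → ∀ i → Finite (powL L i)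
  pow-finite fL zero    = empty-finite
  pow-finite fL (suc i) = ⊎-finite fL (pow-finite fL i)

  ΣL : ∀ {m} → (Fin m → Lang a b) → Lang a b
  ΣL {zero}  L = emptyBagL
  ΣL {suc m} L = L zero ⊎L ΣL (L ∘ suc)

  ΣL-finite : ∀ {m} {L : Fin m → Lang a b} → (∀ c → Finite (L c)) → Finite (ΣL L)
  ΣL-finite {zero}  f = empty-finite
  ΣL-finite {suc m} f = ⊎-finite (f zero) (ΣL-finite (f ∘ suc))

  ΣL-mono : ∀ {m} {L M : Fin m → Lang a b} → (∀ c → L c ⊆ M c) → ΣL L ⊆ ΣL M
  ΣL-mono {zero}  f p = p
  ΣL-mono {suc m} {L} {M} f p = ⊎-mono {L = L zero} {M zero} {ΣL (L ∘ suc)} {ΣL (M ∘ suc)} (f zero) (ΣL-mono (f ∘ suc)) p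

  ΣL-bounded : ∀ {m k} {L : Fin m → Lang a b} → (∀ c → BoundedBy k (L c)) → BoundedBy (m * k) (ΣL L)
  ΣL-bounded {zero}  f p x = ≤-reflexive (p x)
  ΣL-bounded {suc m} f (u , v , p , q , h) x = ≤-trans (≤-reflexive (h x)) (+-mono-≤ (f zero p x) (ΣL-bounded (f ∘ suc) q x))

  twice-⊕ : ∀ {w u v u' v' r s : Bag a b} → w ≗ u ⊕ v → u ≗ (twice u' plus r) → v ≗ (twice v' plus s) →
            w ≗ (twice (u' ⊕ v') plus (r ⊕ s))
  twice-⊕ {w} {u} {v} {u'} {v'} {r} {s} h k l x = trans (h x) (trans (cong₂ _+_ (k x) (l x)) (lem (u' x) (v' x) (r x) (s x)))
    where
    lem : ∀ a b c d → (2 * a + c) + (2 * b + d) ≡ 2 * (a + b) + (c + d)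
    lem = solve-∀

  Halvable : Lang a b → Lang a b → Lang a b → Set
  Halvable L M N = ∀ {w} → L w → ∃₂ λ w' r → w ≗ (twice w' plus r) × M w' × N r

  ⊎-halve : ∀ {L L' M M' N N'} → Halvable L M N → Halvable L' M' N' → Halvable (L ⊎L L') (M ⊎L M') (N ⊎L N')
  ⊎-halve {M = M} {M'} {N} {N'} f g {w} (u , v , p , q , h) with f p | g q
  ... | u' , r , k , p' , r' | v' , s , l , q' , s' = u' ⊕ v' , r ⊕ s , twice-⊕ {w} {u} {v} {u'} {v'} {r} {s} h k l ,
        ⊎-intro {L = M} {M'} p' q' , ⊎-intro {L = N} {N'} r' s'

  empty-halve : Halvable emptyBagL emptyBagL emptyBagL
  empty-halve p = 𝟘 , 𝟘 , p , (λ _ → refl) , λ _ → refl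

  ΣL-halve : ∀ {m} {L M N : Fin m → Lang a b} → (∀ c → Halvable (L c) (M c) (N c)) → Halvable (ΣL L) (ΣL M) (ΣL N)
  ΣL-halve {zero}  f = empty-halve
  ΣL-halve {suc m} {L} {M} {N} f =
    ⊎-halve {L zero} {ΣL (L ∘ suc)} {M zero} {ΣL (M ∘ suc)} {N zero} {ΣL (N ∘ suc)} (f zero) (ΣL-halve (f ∘ suc))

  Doublable : Lang a b → Lang a b → Lang a b → Set
  Doublable L M N = ∀ {w' r} → M w' → N r → L (twice w' plus r)

  ⊎-double : ∀ {L L' M M' N N'} → Doublable L M N → Doublable L' M' N' → Doublable (L ⊎L L') (M ⊎L M') (N ⊎L N')
  ⊎-double f g {w} {t} (u , v , p , q , h) (r , s , p' , q' , h') =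
    (twice u plus r) , (twice v plus s) , f p p' , g q q' ,
    λ x → trans (cong₂ (λ α β → 2 * α + β) (h x) (h' x)) (lem (u x) (v x) (r x) (s x))
    where
    lem : ∀ a b c d → 2 * (a + b) + (c + d) ≡ (2 * a + c) + (2 * b + d)
    lem = solve-∀

  ΣL-double : ∀ {m} {L M N : Fin m → Lang a b} → (∀ c → Doublable (L c) (M c) (N c)) → Doublable (ΣL L) (ΣL M) (ΣL N)
  ΣL-double {zero}  f p q x = cong₂ (λ α β → 2 * α + β) (p x) (q x)
  ΣL-double {suc m} {L} {M} {N} f =
    ⊎-double {L zero} {ΣL (L ∘ suc)} {M zero} {ΣL (M ∘ suc)} {N zero} {ΣL (N ∘ suc)} (f zero) (ΣL-double (f ∘ suc))

  pow-double : ∀ L k d → Doublable (powL L (2 * k + d)) (powL L k) (powL L d)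
  pow-double L k d p q = pow-add L (2 * k) d (pow-add L k (k + 0) p (pow-add L k 0 p (λ _ → refl))) q

-- Halving

-- Binary notation with shifted digits: subtracting `D` before halving leaves a digit `D` or
-- `suc D`, or else a half that vanishes and a digit below `D`. For `D = 0` these are the usual
-- binary digits. Large digits are what `pow-halve` asks for.
half : ℕ → ℕ → ℕ
half D n = ⌊ n ∸ D /2⌋

digit : ℕ → ℕ → ℕ
digit D n = n ∸ 2 * half D n

2*⌊n/2⌋≤n : ∀ n → 2 * ⌊ n /2⌋ ≤ n
2*⌊n/2⌋≤n zero          = z≤n
2*⌊n/2⌋≤n (suc zero)    = z≤n
2*⌊n/2⌋≤n (suc (suc n)) = ≤-trans (≤-reflexive (*-suc 2 ⌊ n /2⌋)) (s≤s (s≤s (2*⌊n/2⌋≤n n)))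

n≤1+2*⌊n/2⌋ : ∀ n → n ≤ suc (2 * ⌊ n /2⌋)
n≤1+2*⌊n/2⌋ zero          = z≤n
n≤1+2*⌊n/2⌋ (suc zero)    = s≤s z≤n
n≤1+2*⌊n/2⌋ (suc (suc n)) = ≤-trans (s≤s (s≤s (n≤1+2*⌊n/2⌋ n))) (≤-reflexive (cong suc (≡-sym (*-suc 2 ⌊ n /2⌋))))

2*half≤ : ∀ D n → 2 * half D n ≤ n
2*half≤ D n = ≤-trans (2*⌊n/2⌋≤n (n ∸ D)) (m∸n≤m n D)

half≤ : ∀ D n → half D n ≤ n
half≤ D n = ≤-trans (⌊n/2⌋≤n (n ∸ D)) (m∸n≤m n D)

half< : ∀ D n → 0 < n → half D n < n
half< D (suc n) _ with suc n ∸ D | m∸n≤m (suc n) D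
... | zero  | _  = s≤s z≤n
... | suc k | le = ≤-trans (⌊n/2⌋<n k) le

half-digit : ∀ D n → 2 * half D n + digit D n ≡ n
half-digit D n = m+[n∸m]≡n (2*half≤ D n)

digit≤ : ∀ D n → digit D n ≤ suc D
digit≤ D n = m≤n+o⇒m∸n≤o n (2 * half D n) (begin
  n                             ≤⟨ m≤n+m∸n n D ⟩
  D + (n ∸ D)                   ≤⟨ +-monoʳ-≤ D (n≤1+2*⌊n/2⌋ (n ∸ D)) ⟩
  D + suc (2 * half D n)        ≡⟨ +-suc D _ ⟩
  suc D + 2 * half D n          ≡⟨ +-comm (suc D) _ ⟩
  2 * half D n + suc D          ∎)
  where open ≤-Reasoning

≤digit : ∀ D n → half D n ≡ 0 ⊎ D ≤ digit D n
≤digit D n with D ≤? n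
... | yes D≤n = inj₂ (m+n≤o⇒m≤o∸n D (≤-trans (+-monoʳ-≤ D (2*⌊n/2⌋≤n (n ∸ D))) (≤-reflexive (m+[n∸m]≡n D≤n))))
... | no D≰n  = inj₁ (cong ⌊_/2⌋ (m≤n⇒m∸n≡0 (<⇒≤ (≰⇒> D≰n))))

module _ {a b : ℕ} where

  pow→fun : ∀ (L : Lang a b) k {w} → powL L k w →
            Σ (Fin k → Bag a b) λ f → (∀ i → L (f i)) × (∀ x → w x ≡ sum (λ i → f i x))
  pow→fun L zero    p = (λ ()) , (λ ()) , p
  pow→fun L (suc k) (u , v , p , q , h) with pow→fun L k q
  ... | f , g , e = (λ { zero → u ; (suc i) → f i }) , (λ { zero → p ; (suc i) → g i }) ,
                    λ x → trans (h x) (cong (u x +_) (e x))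

  fun→pow : ∀ (L : Lang a b) k (f : Fin k → Bag a b) → (∀ i → L (f i)) → powL L k (λ x → sum (λ i → f i x))
  fun→pow L zero    f g x = refl
  fun→pow L (suc k) f g = f zero , _ , g zero , fun→pow L k (f ∘ suc) (g ∘ suc) , λ x → refl

  -- Bounds the number of bags in `L` up to pointwise equality, in the form that the pigeonhole
  -- principle uses.
  record Coded (L : Lang a b) (m : ℕ) : Set where
    field
      code     : ∀ {v} → L v → Fin m
      code-inj : ∀ {u v} (p : L u) (q : L v) → code p ≡ code q → u ≗ v

  open Coded

  -- There are more factors than bags in `L`, so two of them agree; they make up the part `twice v`.
  pow-pair : ∀ {L m} → Coded L m → ∀ k {w} → m < suc (suc k) → powL L (suc (suc k)) w →
             ∃₂ λ v u → L v × powL L k u × w ≗ (twice v plus u)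
  pow-pair {L} C k {w} lt pw with pow→fun L (suc (suc k)) pw
  ... | f , g , e with pigeonhole lt (λ i → code C (g i))
  ... | i , j , i<j , eq = f i , _ , g i , fun→pow L k _ (λ l → g (punchIn i (punchIn j' l))) , λ x → begin
    w x                                         ≡⟨ e x ⟩
    sum (λ l → f l x)                           ≡⟨ sum-remove {i = i} (λ l → f l x) ⟩
    f i x + sum (λ l → f (punchIn i l) x)       ≡⟨ cong (f i x +_) (sum-remove {i = j'} (λ l → f (punchIn i l) x)) ⟩
    f i x + (f (punchIn i j') x + rest x)       ≡⟨ cong (λ l → f i x + (f l x + rest x)) (punchIn-punchOut i≢j) ⟩
    f i x + (f j x + rest x)                    ≡⟨ cong (λ n → f i x + (n + rest x)) (≡-sym (code-inj C (g i) (g j) eq x)) ⟩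
    f i x + (f i x + rest x)                    ≡⟨ lem (f i x) (rest x) ⟩
    2 * f i x + rest x                          ∎
    where
    open ≡-Reasoning
    i≢j : i ≢ j
    i≢j refl = <-irrefl refl i<j
    j' = punchOut i≢j
    rest : Bag a b
    rest x = sum (λ l → f (punchIn i (punchIn j' l)) x)
    lem : ∀ m n → m + (m + n) ≡ 2 * m + n
    lem = solve-∀

  -- Pairs of equal factors are taken out `k` times. Each time at least `suc (suc d)` factors are
  -- present, more than `m`, so a pair exists. With a small `d` the remaining factors could all be
  -- distinct.
  pow-halve : ∀ {L m} → Coded L m → ∀ k d → k ≡ 0 ⊎ m ≤ suc d → Halvable (powL L (2 * k + d)) (powL L k) (powL L d)
  pow-halve C zero    d _ {w} p = 𝟘 , w , (λ _ → refl) , (λ _ → refl) , p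
  pow-halve {L} {m} C (suc k) d (inj₂ le) {w} p = extend (pow-pair C (2 * k + d) lt p')
    where
    lt : m < suc (suc (2 * k + d))
    lt = s≤s (≤-trans le (s≤s (m≤n+m d (2 * k))))
    p' : powL L (suc (suc (2 * k + d))) w
    p' = subst (λ i → powL L (i + d) w) (*-suc 2 k) p
    lem : ∀ x y z → 2 * x + (2 * y + z) ≡ 2 * (x + y) + z
    lem = solve-∀
    extend : (∃₂ λ v u → L v × powL L (2 * k + d) u × w ≗ (twice v plus u)) →
             ∃₂ λ w' r → w ≗ (twice w' plus r) × powL L (suc k) w' × powL L d r
    extend (v , u , pv , pu , e) with pow-halve C k d (inj₂ le) pu
    ... | u' , r , h , pu' , pr = v ⊕ u' , r ,
      (λ x → trans (e x) (trans (cong (2 * v x +_) (h x)) (lem (v x) (u' x) (r x)))) , ⊎-intro {L = L} {powL L k} pv pu' , pr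

  Star : Lang a b → Lang a b
  Star L w = ∃ λ k → powL L k w

  Capped : Lang a b → ℕ → Lang a b
  Capped L k w = L w × (∀ x → w x ≤ k)

  -- Writing the number of factors as `2 * half m k + digit m k` makes `pow-halve` applicable and
  -- leaves at most `suc m` factors for the remainder, each with entries at most `β`.
  star-halve : ∀ {L m β} → Coded L m → BoundedBy β L → Halvable (Star L) (Star L) (Capped (Star L) (suc m * β))
  star-halve {L} {m} {β} C bd {w} (k , p) = cap (pow-halve C (half m k) (digit m k) (cond (≤digit m k)) p')
    where
    cond : half m k ≡ 0 ⊎ m ≤ digit m k → half m k ≡ 0 ⊎ m ≤ suc (digit m k)
    cond (inj₁ e) = inj₁ e
    cond (inj₂ l) = inj₂ (≤-trans l (n≤1+n _))
    p' : powL L (2 * half m k + digit m k) w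
    p' = subst (λ i → powL L i w) (≡-sym (half-digit m k)) p
    cap : (∃₂ λ w' r → w ≗ (twice w' plus r) × powL L (half m k) w' × powL L (digit m k) r) →
          ∃₂ λ w' r → w ≗ (twice w' plus r) × Star L w' × Capped (Star L) (suc m * β) r
    cap (w' , r , h , q , q') = w' , r , h , (half m k , q) , (digit m k , q') ,
      λ x → ≤-trans (pow-bounded bd (digit m k) q' x) (*-monoˡ-≤ β (digit≤ m k))

  Pick : Fin a → (Fin b → Bool) → Lang a b
  Pick l B w = ∃ λ t → B t ≡ true × singleL (l , t) w

  pick-finite : ∀ l B → Finite (Pick l B)
  pick-finite l B = record
    { ext = λ { e (t , p , q) → t , p , single-ext (l , t) e q }
    ; dec = λ w → any? (λ t → (B t Bool.≟ true) ×-dec single-dec (l , t) w)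
    ; height = 1
    ; bounded = λ { (t , p , q) → single≤1 (l , t) q } }

  pick-coded : ∀ l B → Coded (Pick l B) b
  pick-coded l B = record
    { code = proj₁
    ; code-inj = λ { (t , _ , p) (.t , _ , q) refl x → trans (p x) (≡-sym (q x)) } }

  -- The bags obtained by giving each of the x c edges of class c one of its possible types.
  Flow : ∀ {m} → (Fin m → Fin a × (Fin b → Bool)) → (Fin m → ℕ) → Lang a b
  Flow τ x = ΣL (λ c → powL (Pick (proj₁ (τ c)) (proj₂ (τ c))) (x c))

  flow-finite : ∀ {m} (τ : Fin m → Fin a × (Fin b → Bool)) x → Finite (Flow τ x)
  flow-finite τ x = ΣL-finite (λ c → pow-finite (pick-finite (proj₁ (τ c)) (proj₂ (τ c))) (x c))

  flow-bounded : ∀ {m} (τ : Fin m → Fin a × (Fin b → Bool)) {D} x → (∀ c → x c ≤ D) → BoundedBy (m * D) (Flow τ x)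
  flow-bounded τ {D} x h = ΣL-bounded (λ c p y →
    ≤-trans (pow-bounded (Finite.bounded (pick-finite (proj₁ (τ c)) (proj₂ (τ c)))) (x c) p y)
            (≤-trans (≤-reflexive (*-identityʳ (x c))) (h c)))

  flow-halve : ∀ {m} (τ : Fin m → Fin a × (Fin b → Bool)) x d → (∀ c → x c ≡ 0 ⊎ b ≤ suc (d c)) →
               Halvable (Flow τ (λ c → 2 * x c + d c)) (Flow τ x) (Flow τ d)
  flow-halve τ x d h = ΣL-halve (λ c → pow-halve (pick-coded (proj₁ (τ c)) (proj₂ (τ c))) (x c) (d c) (h c))

  flow-double : ∀ {m} (τ : Fin m → Fin a × (Fin b → Bool)) x d →
                Doublable (Flow τ (λ c → 2 * x c + d c)) (Flow τ x) (Flow τ d)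
  flow-double τ x d = ΣL-double (λ c → pow-double (Pick (proj₁ (τ c)) (proj₂ (τ c))) (x c) (d c))

-- Semilinear decomposition of regular bag expressions

n<2^bits : ∀ n → n < 2 ^ bits n
n<2^bits n = ≰⇒> λ le → <-irrefl refl
  (≤-trans (≤-reflexive (≡-sym (⌊log₂[2^n]⌋≡n (bits n)))) (⌊log₂⌋-mono-≤ le))

n<2^n : ∀ n → n < 2 ^ n
n<2^n zero    = s≤s z≤n
n<2^n (suc n) = ≤-trans (+-mono-≤ (m^n>0 2 n) (n<2^n n)) (≤-reflexive (cong (2 ^ n +_) (≡-sym (+-identityʳ _))))

2^-mono : ∀ {m n} → m ≤ n → 2 ^ m ≤ 2 ^ n
2^-mono = ^-monoʳ-≤ 2

2^+2^≤ : ∀ m n → 2 ^ m + 2 ^ n ≤ 2 ^ suc (m + n)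
2^+2^≤ m n = ≤-trans (+-mono-≤ (2^-mono (m≤m+n m n)) (2^-mono (m≤n+m n m)))
  (≤-reflexive (cong (2 ^ (m + n) +_) (≡-sym (+-identityʳ _))))

bit : Bool → ℕ
bit f = if f then 1 else 0

module _ {a b : ℕ} where

  -- A pattern records which of the unbounded iterations in E are entered.
  Pat : RBE a b → Set
  Pat ε        = ⊤
  Pat (sym _)  = ⊤
  Pat (E ∣ F)  = Pat E × Pat F
  Pat (E ∥ F)  = Pat E × Pat F
  Pat (E ^ᴵ I) = Bool × Pat E

  bot : ∀ E → Pat E
  bot ε        = tt
  bot (sym _)  = tt
  bot (E ∣ F)  = bot E , bot F
  bot (E ∥ F)  = bot E , bot F
  bot (E ^ᴵ I) = false , bot E

  join : ∀ E → Pat E → Pat E → Pat E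
  join ε        _       _         = tt
  join (sym _)  _       _         = tt
  join (E ∣ F)  (U , V) (U' , V') = join E U U' , join F V V'
  join (E ∥ F)  (U , V) (U' , V') = join E U U' , join F V V'
  join (E ^ᴵ I) (f , U) (f' , U') = f ∨ f' , join E U U'

  rank : ∀ E → Pat E → ℕ
  rank ε        _       = 0
  rank (sym _)  _       = 0
  rank (E ∣ F)  (U , V) = rank E U + rank F V
  rank (E ∥ F)  (U , V) = rank E U + rank F V
  rank (E ^ᴵ I) (f , U) = bit f + rank E U

  rank≤size : ∀ E U → rank E U ≤ sizeE E
  rank≤size ε        _       = z≤n
  rank≤size (sym _)  _       = z≤n
  rank≤size (E ∣ F)  (U , V) = ≤-trans (+-mono-≤ (rank≤size E U) (rank≤size F V)) (n≤1+n _)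
  rank≤size (E ∥ F)  (U , V) = ≤-trans (+-mono-≤ (rank≤size E U) (rank≤size F V)) (n≤1+n _)
  rank≤size (E ^ᴵ I) (true  , U) = s≤s (≤-trans (rank≤size E U) (m≤m+n _ _))
  rank≤size (E ^ᴵ I) (false , U) = ≤-trans (rank≤size E U) (≤-trans (m≤m+n _ _) (n≤1+n _))

  bit-join : ∀ f g → bit g ≤ bit (f ∨ g)
  bit-join f     false = z≤n
  bit-join true  true  = ≤-refl
  bit-join false true  = ≤-refl

  rank-join : ∀ E U V → rank E V ≤ rank E (join E U V)
  rank-join ε        _       _         = z≤n
  rank-join (sym _)  _       _         = z≤n
  rank-join (E ∣ F)  (U , V) (U' , V') = +-mono-≤ (rank-join E U U') (rank-join F V V')
  rank-join (E ∥ F)  (U , V) (U' , V') = +-mono-≤ (rank-join E U U') (rank-join F V V')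
  rank-join (E ^ᴵ I) (f , U) (f' , U') = +-mono-≤ (bit-join f f') (rank-join E U U')

  +-tight : ∀ {m m' n n'} → m ≤ m' → n ≤ n' → m' + n' ≤ m + n → m' ≤ m × n' ≤ n
  +-tight {m} {m'} {n} {n'} p q r =
    +-cancelʳ-≤ n' m' m (≤-trans r (+-monoʳ-≤ m q)) , +-cancelˡ-≤ m' n' n (≤-trans r (+-monoˡ-≤ n p))

  -- The rank is a sum of terms that are monotone under `join`, so if the sum does not grow, no term
  -- does. In `shorten` it shows that a pass which does not raise the rank leaves the pattern as it
  -- was.
  rank-full : ∀ E U V → rank E (join E U V) ≤ rank E V → join E U V ≡ V
  rank-full ε        _       _         _ = refl
  rank-full (sym _)  _       _         _ = refl
  rank-full (E ∣ F)  (U , V) (U' , V') h with +-tight (rank-join E U U') (rank-join F V V') h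
  ... | p , q = cong₂ _,_ (rank-full E U U' p) (rank-full F V V' q)
  rank-full (E ∥ F)  (U , V) (U' , V') h with +-tight (rank-join E U U') (rank-join F V V') h
  ... | p , q = cong₂ _,_ (rank-full E U U' p) (rank-full F V V' q)
  rank-full (E ^ᴵ I) (f , U) (f' , U') h with +-tight (bit-join f f') (rank-join E U U') h
  ... | p , q = cong₂ _,_ (flag f f' p) (rank-full E U U' q)
    where
    flag : ∀ f g → bit (f ∨ g) ≤ bit g → f ∨ g ≡ g
    flag false g     _ = refl
    flag true  true  _ = refl
    flag true  false ()

  -- Stated for an arbitrary set `P` of patterns and family `B`, so that `Basic` can use it on a
  -- subexpression while `Basic` itself is being defined.
  PatPow : ∀ {P : Set} → P → (P → P → P) → (P → Lang a b) → ℕ → P → Lang a b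
  PatPow ⊥P _∪P_ B zero    U w = U ≡ ⊥P × emptyBagL w
  PatPow ⊥P _∪P_ B (suc i) U w = ∃₂ λ V V' → U ≡ V ∪P V' × (B V ⊎L PatPow ⊥P _∪P_ B i V') w

  -- Large enough for every exponent below a finite upper bound, whose bits are counted in
  -- `sizeI I`, and, if there is none, for `lo ⊔ 1` passes and one more for each iteration inside
  -- `E`.
  cap : Interval → RBE a b → ℕ
  cap I E = 2 ^ (sizeI I + sizeE E)

  -- The bags of E with pattern U in whose derivation every iteration is short.
  Basic : ∀ E → Pat E → Lang a b
  Basic ε        _       w = emptyBagL w
  Basic (sym s)  _       w = singleL s w
  Basic (E ∣ F)  (U , V) w = (Basic E U w × V ≡ bot F) ⊎ (U ≡ bot E × Basic F V w)
  Basic (E ∥ F)  (U , V) w = (Basic E U ⊎L Basic F V) w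
  Basic (E ^ᴵ I) (f , U) w = ∃ λ i → i ∈I I × i ≤ cap I E × (f ≡ true → 1 ≤ i) × PatPow (bot E) (join E) (Basic E) i U w

  AnyBasic : RBE a b → Lang a b
  AnyBasic E w = ∃ λ U → Basic E U w

  Slot : Bound → Bool → Lang a b → Lang a b
  Slot ∞       true  L = Star L
  Slot ∞       false L = emptyBagL
  Slot (fin _) _     L = emptyBagL

  -- What may be added to a bag of E with pattern U: further passes through the iterations that are entered.
  Periods : ∀ E → Pat E → Lang a b
  Periods ε        _       = emptyBagL
  Periods (sym _)  _       = emptyBagL
  Periods (E ∣ F)  (U , V) = Periods E U ⊎L Periods F V
  Periods (E ∥ F)  (U , V) = Periods E U ⊎L Periods F V
  Periods (E ^ᴵ I) (f , U) = Slot (Interval.hi I) f (AnyBasic E) ⊎L Periods E U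

  slot-zero : ∀ B f L {w} → emptyBagL w → Slot B f L w
  slot-zero ∞       true  L p = 0 , p
  slot-zero ∞       false L p = p
  slot-zero (fin _) _     L p = p

  ⊎-zero : ∀ {L M : Lang a b} → L 𝟘 → M 𝟘 → ∀ {w} → emptyBagL w → (L ⊎L M) w
  ⊎-zero p q e = 𝟘 , 𝟘 , p , q , e

  periods-zero : ∀ E U {w} → emptyBagL w → Periods E U w
  periods-zero ε        _       p = p
  periods-zero (sym _)  _       p = p
  periods-zero (E ∣ F)  (U , V) p = ⊎-zero {Periods E U} {Periods F V} (periods-zero E U λ _ → refl) (periods-zero F V λ _ → refl) p
  periods-zero (E ∥ F)  (U , V) p = ⊎-zero {Periods E U} {Periods F V} (periods-zero E U λ _ → refl) (periods-zero F V λ _ → refl) p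
  periods-zero (E ^ᴵ I) (f , U) p = ⊎-zero {Slot (Interval.hi I) f (AnyBasic E)} {Periods E U}
    (slot-zero (Interval.hi I) f (AnyBasic E) λ _ → refl) (periods-zero E U λ _ → refl) p

  ⊎-empty : ∀ {L M : Lang a b} → L ⊆ emptyBagL → M ⊆ emptyBagL → (L ⊎L M) ⊆ emptyBagL
  ⊎-empty f g (u , v , p , q , h) x = trans (h x) (cong₂ _+_ (f p x) (g q x))

  slot-false : ∀ B L → Slot B false L ⊆ emptyBagL
  slot-false ∞       L p = p
  slot-false (fin _) L p = p

  -- Explains the use of `bot` in `Basic` for the branch of a union that is not taken, and in
  -- `PatPow` for a power without factors: nothing can be added through iterations that were not
  -- entered.
  periods-bot : ∀ E → Periods E (bot E) ⊆ emptyBagL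
  periods-bot ε        p = p
  periods-bot (sym _)  p = p
  periods-bot (E ∣ F)  = ⊎-empty {Periods E (bot E)} {Periods F (bot F)} (periods-bot E) (periods-bot F)
  periods-bot (E ∥ F)  = ⊎-empty {Periods E (bot E)} {Periods F (bot F)} (periods-bot E) (periods-bot F)
  periods-bot (E ^ᴵ I) = ⊎-empty {Slot (Interval.hi I) false (AnyBasic E)} {Periods E (bot E)}
    (slot-false (Interval.hi I) (AnyBasic E)) (periods-bot E)

  ≗-interchange : ∀ {w w' u v u' v' : Bag a b} → w ≗ u ⊕ v → w' ≗ u' ⊕ v' → w ⊕ w' ≗ (u ⊕ u') ⊕ (v ⊕ v')
  ≗-interchange {u = u} {v} {u'} {v'} h h' x = trans (cong₂ _+_ (h x) (h' x)) (interchange (u x) (v x) (u' x) (v' x))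

  Joins : Lang a b → Lang a b → Lang a b → Set
  Joins L M N = ∀ {u v} → L u → M v → N (u ⊕ v)

  ⊎-joins : ∀ {L M N L' M' N'} → Joins L M N → Joins L' M' N' → Joins (L ⊎L L') (M ⊎L M') (N ⊎L N')
  ⊎-joins f g {w} {w'} (u , v , p , q , h) (u' , v' , p' , q' , h') =
    u ⊕ u' , v ⊕ v' , f p p' , g q q' , ≗-interchange {w} {w'} {u} {v} {u'} {v'} h h'

  empty-joins : Joins emptyBagL emptyBagL emptyBagL
  empty-joins p q x = cong₂ _+_ (p x) (q x)

  slot-joins : ∀ B f g L → Joins (Slot B f L) (Slot B g L) (Slot B (f ∨ g) L)
  slot-joins (fin _) f     g     L         = empty-joins
  slot-joins ∞       false false L         = empty-joins
  slot-joins ∞       true  true  L (i , p) (j , q) = i + j , pow-add L i j p q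
  slot-joins ∞       true  false L {u} {v} (i , p) q = i , pow-ext L i (λ x → ≡-sym (trans (cong (u x +_) (q x)) (+-identityʳ _))) p
  slot-joins ∞       false true  L {u} {v} p (j , q) = j , pow-ext L j (λ x → ≡-sym (cong (_+ v x) (p x))) q

  periods-join : ∀ E U V → Joins (Periods E U) (Periods E V) (Periods E (join E U V))
  periods-join ε        _       _         = empty-joins
  periods-join (sym _)  _       _         = empty-joins
  periods-join (E ∣ F)  (U , V) (U' , V') = ⊎-joins {Periods E U} {Periods E U'} {Periods E (join E U U')}
    {Periods F V} {Periods F V'} {Periods F (join F V V')} (periods-join E U U') (periods-join F V V')
  periods-join (E ∥ F)  (U , V) (U' , V') = ⊎-joins {Periods E U} {Periods E U'} {Periods E (join E U U')}
    {Periods F V} {Periods F V'} {Periods F (join F V V')} (periods-join E U U') (periods-join F V V')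
  periods-join (E ^ᴵ I) (f , U) (g , V)   =
    ⊎-joins {Slot hi f (AnyBasic E)} {Slot hi g (AnyBasic E)} {Slot hi (f ∨ g) (AnyBasic E)}
      {Periods E U} {Periods E V} {Periods E (join E U V)} (slot-joins hi f g (AnyBasic E)) (periods-join E U V)
    where open Interval I

  ⊎-splits : ∀ {L M N L' M' N' : Lang a b} → N ⊆ (L ⊎L M) → N' ⊆ (L' ⊎L M') → (N ⊎L N') ⊆ ((L ⊎L L') ⊎L (M ⊎L M'))
  ⊎-splits {L} {M} {N} {L'} {M'} {N'} f g {w} (u , v , p , q , h) with f p | g q
  ... | s , t , ps , pt , e | s' , t' , ps' , pt' , e' =
    s ⊕ s' , t ⊕ t' , ⊎-intro {L = L} {L'} ps ps' , ⊎-intro {L = M} {M'} pt pt' ,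
    λ x → trans (h x) (≗-interchange {u} {v} {s} {t} {s'} {t'} e e' x)

  empty-splits : emptyBagL ⊆ (emptyBagL {a} {b} ⊎L emptyBagL)
  empty-splits p = 𝟘 , 𝟘 , (λ _ → refl) , (λ _ → refl) , p

  slot-splits : ∀ B f g L → Slot B (f ∨ g) L ⊆ (Slot B f L ⊎L Slot B g L)
  slot-splits (fin _) f     g     L = empty-splits
  slot-splits ∞       false g     L {w} p = 𝟘 , w , (λ _ → refl) , p , λ _ → refl
  slot-splits ∞       true  g     L {w} p = w , 𝟘 , p , slot-zero ∞ g L (λ _ → refl) , λ x → ≡-sym (+-identityʳ (w x))

  -- An iteration entered in the join is entered in one of the two patterns, so its periods can be
  -- handed to that one. In `patpow-sound` this returns the periods of a power to passes that may
  -- absorb them.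
  periods-split : ∀ E U V → Periods E (join E U V) ⊆ (Periods E U ⊎L Periods E V)
  periods-split ε        _       _         = empty-splits
  periods-split (sym _)  _       _         = empty-splits
  periods-split (E ∣ F)  (U , V) (U' , V') = ⊎-splits {Periods E U} {Periods E U'} {Periods E (join E U U')}
    {Periods F V} {Periods F V'} {Periods F (join F V V')} (periods-split E U U') (periods-split F V V')
  periods-split (E ∥ F)  (U , V) (U' , V') = ⊎-splits {Periods E U} {Periods E U'} {Periods E (join E U U')}
    {Periods F V} {Periods F V'} {Periods F (join F V V')} (periods-split E U U') (periods-split F V V')
  periods-split (E ^ᴵ I) (f , U) (g , V)   =
    ⊎-splits {Slot hi f (AnyBasic E)} {Slot hi g (AnyBasic E)} {Slot hi (f ∨ g) (AnyBasic E)}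
      {Periods E U} {Periods E V} {Periods E (join E U V)} (slot-splits hi f g (AnyBasic E)) (periods-split E U V)
    where open Interval I

  patpow-sound : ∀ E → (∀ U → Joins (Basic E U) (Periods E U) ⟦ E ⟧) →
                 ∀ i U → Joins (PatPow (bot E) (join E) (Basic E) i U) (Periods E U) (powL ⟦ E ⟧ i)
  patpow-sound E ih zero    U (refl , p) q = empty-joins p (periods-bot E q)
  patpow-sound E ih (suc i) U {s} {t} (V , V' , refl , u , v , p , p' , h) q with periods-split E V V' q
  ... | u' , v' , q' , q'' , h' = u ⊕ u' , v ⊕ v' , ih V p q' , patpow-sound E ih i V' p' q'' ,
        ≗-interchange {s} {t} {u} {v} {u'} {v'} h h'

  ≤B-∞ : ∀ I → Interval.hi I ≡ ∞ → ∀ i → i ≤B Interval.hi I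
  ≤B-∞ I e i = subst (i ≤B_) (≡-sym e) tt

  iter-sound : ∀ E I f → (∀ {v} → AnyBasic E v → ⟦ E ⟧ v) → ∀ i → i ∈I I → ∀ {u p s} → powL ⟦ E ⟧ i (u ⊕ p) →
               Slot (Interval.hi I) f (AnyBasic E) s → ⟦ E ^ᴵ I ⟧ (u ⊕ (s ⊕ p))
  iter-sound E I f any i (l , r) {u} {p} {s} pw sl = go (Interval.hi I) refl f sl
    where
    swap : ∀ x → (u x + p x) + s x ≡ u x + (s x + p x)
    swap x = trans (+-assoc (u x) (p x) (s x)) (cong (u x +_) (+-comm (p x) (s x)))
    none : emptyBagL s → ⟦ E ^ᴵ I ⟧ (u ⊕ (s ⊕ p))
    none e = i , (l , r) , pow-ext ⟦ E ⟧ i (λ x → cong (λ n → u x + (n + p x)) (≡-sym (e x))) pw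
    go : ∀ B → Interval.hi I ≡ B → ∀ f → Slot B f (AnyBasic E) s → ⟦ E ^ᴵ I ⟧ (u ⊕ (s ⊕ p))
    go (fin _) _ f     e       = none e
    go ∞       _ false e       = none e
    go ∞       h true  (k , q) = i + k , (≤-trans l (m≤m+n i k) , ≤B-∞ I h (i + k)) ,
      pow-ext ⟦ E ⟧ (i + k) swap (pow-add ⟦ E ⟧ i k pw (pow-mono {L = AnyBasic E} {⟦ E ⟧} any k q))

  +-zeroʳ : ∀ (w : Bag a b) {v} → emptyBagL v → w ≗ w ⊕ v
  +-zeroʳ w e x = ≡-sym (trans (cong (w x +_) (e x)) (+-identityʳ (w x)))

  sound : ∀ E U → Joins (Basic E U) (Periods E U) ⟦ E ⟧
  basic-sound : ∀ E {w} → AnyBasic E w → ⟦ E ⟧ w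

  sound ε       _ p q = empty-joins p q
  sound (sym s) _ {u} {v} p q = single-ext s (+-zeroʳ u q) p
  sound (E ∣ F) (U , V) {u} (inj₁ (p , refl)) (s , t , q , q' , h) =
    inj₁ (⟦⟧-ext E (λ x → cong (u x +_) (≡-sym (trans (h x) (trans (cong (s x +_) (periods-bot F q' x)) (+-identityʳ (s x)))))) (sound E U p q))
  sound (E ∣ F) (U , V) {u} (inj₂ (refl , p)) (s , t , q , q' , h) =
    inj₂ (⟦⟧-ext F (λ x → cong (u x +_) (≡-sym (trans (h x) (cong (_+ t x) (periods-bot E q x))))) (sound F V p q'))
  sound (E ∥ F) (U , V) = ⊎-joins {Basic E U} {Periods E U} {⟦ E ⟧} {Basic F V} {Periods F V} {⟦ F ⟧} (sound E U) (sound F V)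
  sound (E ^ᴵ I) (f , U) {u} (i , m , _ , _ , p) (s , t , q , q' , h) =
    ⟦⟧-ext (E ^ᴵ I) (λ x → cong (u x +_) (≡-sym (h x)))
      (iter-sound E I f (basic-sound E) i m {u} {t} {s} (patpow-sound E (sound E) i U p q') q)

  basic-sound E {w} (U , p) = ⟦⟧-ext E (λ x → +-identityʳ (w x)) (sound E U p (periods-zero E U {𝟘} λ _ → refl))

  Rep : ∀ E → Pat E → Lang a b
  Rep E U = Basic E U ⊎L Periods E U

  -- Each pass consists of a basic bag and periods of its own pattern; the periods of all passes are
  -- collected under the join of the patterns. They remain available when `shorten` removes passes,
  -- since the pattern is preserved there.
  patpow-complete : ∀ E → (∀ {w} → ⟦ E ⟧ w → ∃ λ U → Rep E U w) → ∀ i {w} → powL ⟦ E ⟧ i w →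
                    ∃ λ U → (PatPow (bot E) (join E) (Basic E) i U ⊎L Periods E U) w
  patpow-complete E ih zero p = bot E , 𝟘 , 𝟘 , (refl , λ _ → refl) , periods-zero E (bot E) (λ _ → refl) , p
  patpow-complete E ih (suc i) (u , v , p , q , h) with ih p | patpow-complete E ih i q
  ... | U , s , t , ps , pt , e | V , s' , t' , ps' , pt' , e' =
    join E U V , s ⊕ s' , t ⊕ t' , (U , V , refl , s , s' , ps , ps' , λ _ → refl) , periods-join E U V pt pt' ,
    λ x → trans (h x) (≗-interchange {u} {v} {s} {t} {s'} {t'} e e' x)

  Short : ∀ E → ℕ → Pat E → Lang a b
  Short E l U w = ∃ λ i → l ≤ i × i ≤ l + rank E U × (PatPow (bot E) (join E) (Basic E) i U ⊎L Star (AnyBasic E)) w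

  -- Beyond the first l passes, only those that enlarge the pattern have to be kept; the others are periods.
  shorten : ∀ E l j U → PatPow (bot E) (join E) (Basic E) (j + l) U ⊆ Short E l U
  shorten E l zero    U {w} p = l , ≤-refl , m≤m+n l _ , w , 𝟘 , p , (0 , λ _ → refl) , λ x → ≡-sym (+-identityʳ (w x))
  shorten E l (suc j) _ {w} (U , V , refl , u , v , p , q , h) = add (shorten E l j V q)
    where
    add : Short E l V v → Short E l (join E U V) w
    add (i , l≤i , i≤ , s , t , ps , (k , pt) , e) with rank E (join E U V) ≤? rank E V
    ... | yes le = i , l≤i , ≤-trans i≤ (+-monoʳ-≤ l (rank-join E U V)) , s , u ⊕ t ,
          subst (λ V' → PatPow (bot E) (join E) (Basic E) i V' s) (≡-sym (rank-full E U V le)) ps ,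
          (suc k , u , t , (U , p) , pt , λ _ → refl) ,
          λ x → trans (h x) (trans (cong (u x +_) (e x)) (x∙yz≈y∙xz (u x) (s x) (t x)))
    ... | no nle = suc i , ≤-trans l≤i (n≤1+n i) ,
          ≤-trans (s≤s i≤) (≤-trans (≤-reflexive (≡-sym (+-suc l _))) (+-monoʳ-≤ l (≰⇒> nle))) , u ⊕ s , t ,
          (U , V , refl , u , s , p , ps , λ _ → refl) , (k , pt) ,
          λ x → trans (h x) (trans (cong (u x +_) (e x)) (≡-sym (+-assoc (u x) (s x) (t x))))

  lo⊔1+rank≤cap : ∀ I E U → (Interval.lo I ⊔ 1) + rank E U ≤ cap I E
  lo⊔1+rank≤cap I E U = begin
    (lo ⊔ 1) + rank E U                 ≤⟨ +-mono-≤ (⊔-lub (<⇒≤ (n<2^bits lo)) (m^n>0 2 (bits lo))) (≤-trans (rank≤size E U) (<⇒≤ (n<2^n (sizeE E)))) ⟩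
    2 ^ bits lo + 2 ^ sizeE E           ≤⟨ +-mono-≤ (2^-mono (m≤m+n (bits lo) (sizeB hi + sizeE E))) (2^-mono (≤-trans (m≤n+m (sizeE E) (sizeB hi)) (m≤n+m _ (bits lo)))) ⟩
    2 ^ m + 2 ^ m                       ≡⟨ cong (2 ^ m +_) (≡-sym (+-identityʳ _)) ⟩
    2 ^ suc m                           ≡⟨ cong (2 ^_) (cong suc (≡-sym (+-assoc (bits lo) (sizeB hi) (sizeE E)))) ⟩
    cap I E                             ∎
    where
    open Interval I
    open ≤-Reasoning
    m = bits lo + (sizeB hi + sizeE E)

  fin≤cap : ∀ I E i → i ≤B Interval.hi I → Interval.hi I ≢ ∞ → i ≤ cap I E
  fin≤cap (mkInterval lo (fin m) _) E i h _ = ≤-trans h (≤-trans (<⇒≤ (n<2^bits m))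
    (2^-mono (≤-trans (m≤n+m (bits m) (suc (bits lo))) (m≤m+n _ (sizeE E)))))
  fin≤cap (mkInterval lo ∞ _) E i h n = ⊥-elim (n refl)

  iter-complete : ∀ E I i → i ∈I I → ∀ U {w} → (PatPow (bot E) (join E) (Basic E) i U ⊎L Periods E U) w → ∃ λ V → Rep (E ^ᴵ I) V w
  iter-complete E I@(mkInterval lo (fin m) _) i (l , r) U (u , v , p , q , h) =
    (false , U) , u , 𝟘 ⊕ v , (i , (l , r) , fin≤cap I E i r (λ ()) , (λ ()) , p) ,
    (𝟘 , v , (λ _ → refl) , q , λ _ → refl) , h
  iter-complete E I@(mkInterval lo ∞ _) zero (l , r) U (u , v , p , q , h) =
    (false , U) , u , 𝟘 ⊕ v , (0 , (l , r) , z≤n , (λ ()) , p) , (𝟘 , v , (λ _ → refl) , q , λ _ → refl) , h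
  iter-complete E I@(mkInterval lo ∞ _) (suc i) (l , r) U {w} (u , v , p , q , h) =
    collect (shorten E k (suc i ∸ k) U (subst (λ n → PatPow (bot E) (join E) (Basic E) n U u) (≡-sym (m∸n+n≡m k≤i)) p))
    where
    -- `lo ⊔ 1` in place of `lo`, because the flag `true` demands that at least one pass is kept.
    k = lo ⊔ 1
    k≤i : k ≤ suc i
    k≤i = ⊔-lub l (s≤s z≤n)
    collect : Short E k U u → ∃ λ V → Rep (E ^ᴵ I) V w
    collect (n , k≤n , n≤ , s , t , ps , pt , e) =
      (true , U) , s , t ⊕ v ,
      (n , (≤-trans (m≤m⊔n lo 1) k≤n , tt) , ≤-trans n≤ (lo⊔1+rank≤cap I E U) , (λ _ → ≤-trans (m≤n⊔m lo 1) k≤n) , ps) ,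
      (t , v , pt , q , λ _ → refl) ,
      λ x → trans (h x) (trans (cong (_+ v x) (e x)) (+-assoc (s x) (t x) (v x)))

  complete : ∀ E {w} → ⟦ E ⟧ w → ∃ λ U → Rep E U w
  complete ε       {w} p = tt , w , 𝟘 , p , (λ _ → refl) , λ x → ≡-sym (+-identityʳ (w x))
  complete (sym s) {w} p = tt , w , 𝟘 , p , (λ _ → refl) , λ x → ≡-sym (+-identityʳ (w x))
  complete (E ∣ F) (inj₁ p) with complete E p
  ... | U , u , v , q , q' , h = (U , bot F) , u , v , inj₁ (q , refl) ,
        (v , 𝟘 , q' , periods-zero F (bot F) (λ _ → refl) , λ x → ≡-sym (+-identityʳ (v x))) , h
  complete (E ∣ F) (inj₂ p) with complete F p
  ... | V , u , v , q , q' , h = (bot E , V) , u , v , inj₂ (refl , q) ,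
        (𝟘 , v , periods-zero E (bot E) (λ _ → refl) , q' , λ x → refl) , h
  complete (E ∥ F) (s , t , p , q , h) with complete E p | complete F q
  ... | U , u , v , q₁ , q₂ , e | V , u' , v' , q₁' , q₂' , e' =
    (U , V) , u ⊕ u' , v ⊕ v' , ⊎-intro {L = Basic E U} {Basic F V} q₁ q₁' , ⊎-intro {L = Periods E U} {Periods F V} q₂ q₂' ,
    λ x → trans (h x) (≗-interchange {s} {t} {u} {v} {u'} {v'} e e' x)
  complete (E ^ᴵ I) (i , m , p) with patpow-complete E (complete E) i p
  ... | U , q = iter-complete E I i m U q

  β : RBE a b → ℕ
  β ε        = 0
  β (sym _)  = 1
  β (E ∣ F)  = β E + β F
  β (E ∥ F)  = β E + β F
  β (E ^ᴵ I) = cap I E * β E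

  basic-bounded : ∀ E U → BoundedBy (β E) (Basic E U)
  patpow-bounded : ∀ E i U → BoundedBy (i * β E) (PatPow (bot E) (join E) (Basic E) i U)

  basic-bounded ε        _ p x = ≤-reflexive (p x)
  basic-bounded (sym s)  _ p x = single≤1 s p x
  basic-bounded (E ∣ F)  (U , V) (inj₁ (p , _)) x = ≤-trans (basic-bounded E U p x) (m≤m+n _ _)
  basic-bounded (E ∣ F)  (U , V) (inj₂ (_ , p)) x = ≤-trans (basic-bounded F V p x) (m≤n+m _ _)
  basic-bounded (E ∥ F)  (U , V) (u , v , p , q , h) x = ≤-trans (≤-reflexive (h x)) (+-mono-≤ (basic-bounded E U p x) (basic-bounded F V q x))
  basic-bounded (E ^ᴵ I) (f , U) (i , _ , le , _ , p) x = ≤-trans (patpow-bounded E i U p x) (*-monoˡ-≤ (β E) le)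

  patpow-bounded E zero    U (_ , p) x = ≤-reflexive (p x)
  patpow-bounded E (suc i) U (V , V' , _ , u , v , p , q , h) x =
    ≤-trans (≤-reflexive (h x)) (+-mono-≤ (basic-bounded E V p x) (patpow-bounded E i V' q x))

  anyBasic-bounded : ∀ E → BoundedBy (β E) (AnyBasic E)
  anyBasic-bounded E (U , p) = basic-bounded E U p

  anyBasic-coded : ∀ E → Coded (AnyBasic E) (BagCode {a} {b} (β E))
  anyBasic-coded E = record
    { code = λ {v} p → codeOf (β E) v (anyBasic-bounded E p)
    ; code-inj = λ {u} {v} p q e x → trans (≡-sym (bagOf-codeOf (β E) u (anyBasic-bounded E p) x))
        (trans (cong (λ i → bagOf (β E) i x) e) (bagOf-codeOf (β E) v (anyBasic-bounded E q) x)) }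

  -- Every iteration contributes the remainder bound of `star-halve`, with `BagCode (β E)` as the
  -- number of generators; the contributions of nested and parallel iterations add up.
  γ : RBE a b → ℕ
  γ ε        = 0
  γ (sym _)  = 0
  γ (E ∣ F)  = γ E + γ F
  γ (E ∥ F)  = γ E + γ F
  γ (E ^ᴵ I) = suc (BagCode {a} {b} (β E)) * β E + γ E

  CappedHalvable : Lang a b → ℕ → Set
  CappedHalvable L k = Halvable L L (Capped L k)

  capped-⊎ : ∀ {L M : Lang a b} {k l} → CappedHalvable L k → CappedHalvable M l → CappedHalvable (L ⊎L M) (k + l)
  capped-⊎ {L} {M} {k} {l} f g p with ⊎-halve {L = L} {M} {L} {M} {Capped L k} {Capped M l} f g p
  ... | w' , r , h , q , (u , v , (pu , bu) , (pv , bv) , e) = w' , r , h , q , (u , v , pu , pv , e) ,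
        λ x → ≤-trans (≤-reflexive (e x)) (+-mono-≤ (bu x) (bv x))

  capped-empty : ∀ k → CappedHalvable emptyBagL k
  capped-empty k p = 𝟘 , 𝟘 , p , (λ _ → refl) , (λ _ → refl) , λ _ → z≤n

  slot-halve : ∀ B f E → CappedHalvable (Slot B f (AnyBasic E)) (suc (BagCode {a} {b} (β E)) * β E)
  slot-halve (fin _) f     E = capped-empty _
  slot-halve ∞       false E = capped-empty _
  slot-halve ∞       true  E = star-halve (anyBasic-coded E) (anyBasic-bounded E)

  periods-halve : ∀ E U → CappedHalvable (Periods E U) (γ E)
  periods-halve ε        _       = capped-empty 0
  periods-halve (sym _)  _       = capped-empty 0
  periods-halve (E ∣ F)  (U , V) = capped-⊎ {Periods E U} {Periods F V} (periods-halve E U) (periods-halve F V)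
  periods-halve (E ∥ F)  (U , V) = capped-⊎ {Periods E U} {Periods F V} (periods-halve E U) (periods-halve F V)
  periods-halve (E ^ᴵ I) (f , U) = capped-⊎ {Slot (Interval.hi I) f (AnyBasic E)} {Periods E U}
    (slot-halve (Interval.hi I) f E) (periods-halve E U)

  slot-double : ∀ B f L → Doublable (Slot B f L) (Slot B f L) (Slot B f L)
  slot-double (fin _) f     L p q x = cong₂ (λ m n → 2 * m + n) (p x) (q x)
  slot-double ∞       false L p q x = cong₂ (λ m n → 2 * m + n) (p x) (q x)
  slot-double ∞       true  L (i , p) (j , q) = 2 * i + j , pow-double L i j p q

  periods-double : ∀ E U → Doublable (Periods E U) (Periods E U) (Periods E U)
  periods-double ε        _       p q x = cong₂ (λ m n → 2 * m + n) (p x) (q x)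
  periods-double (sym _)  _       p q x = cong₂ (λ m n → 2 * m + n) (p x) (q x)
  periods-double (E ∣ F)  (U , V) = ⊎-double {L = Periods E U} {Periods F V} {Periods E U} {Periods F V} {Periods E U} {Periods F V}
    (periods-double E U) (periods-double F V)
  periods-double (E ∥ F)  (U , V) = ⊎-double {L = Periods E U} {Periods F V} {Periods E U} {Periods F V} {Periods E U} {Periods F V}
    (periods-double E U) (periods-double F V)
  periods-double (E ^ᴵ I) (f , U) =
    ⊎-double {L = S} {Periods E U} {S} {Periods E U} {S} {Periods E U} (slot-double (Interval.hi I) f (AnyBasic E)) (periods-double E U)
    where S = Slot (Interval.hi I) f (AnyBasic E)

-- Recognition digit by digit

-- Only one composite is the identity, so `enum` may repeat values and `n` may be rounded up, as in
-- `enum-pad`.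
record Enumeration (A : Set) (n : ℕ) : Set where
  field
    enum   : Fin n → A
    index  : A → Fin n
    enum-index : ∀ x → enum (index x) ≡ x

open Enumeration

enum-⊤ : Enumeration ⊤ 1
enum-⊤ = record { enum = λ _ → tt ; index = λ _ → zero ; enum-index = λ _ → refl }

enum-Bool : Enumeration Bool 2
enum-Bool = record
  { enum = λ { zero → false ; (suc _) → true }
  ; index = λ { false → zero ; true → suc zero }
  ; enum-index = λ { false → refl ; true → refl } }

enum-× : ∀ {A B m n} → Enumeration A m → Enumeration B n → Enumeration (A × B) (m * n)
enum-× {m = m} {n} e f = record
  { enum = λ i → enum e (proj₁ (remQuot {m} n i)) , enum f (proj₂ (remQuot {m} n i))
  ; index = λ (x , y) → combine (index e x) (index f y)
  ; enum-index = λ (x , y) → cong₂ _,_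
      (trans (cong (λ p → enum e (proj₁ p)) (remQuot-combine (index e x) (index f y))) (enum-index e x))
      (trans (cong (λ p → enum f (proj₂ p)) (remQuot-combine (index e x) (index f y))) (enum-index f y)) }

triple : ∀ {k l m} → Fin (k * (l * m)) → Fin k × Fin l × Fin m
triple {k} {l} {m} i = proj₁ (remQuot {k} (l * m) i) , remQuot {l} m (proj₂ (remQuot {k} (l * m) i))

untriple : ∀ {k l m} → Fin k → Fin l → Fin m → Fin (k * (l * m))
untriple i j k = combine i (combine j k)

triple-untriple : ∀ {k l m} (i : Fin k) (j : Fin l) (o : Fin m) → triple (untriple i j o) ≡ (i , j , o)
triple-untriple {k} {l} {m} i j o = trans
  (cong (λ p → proj₁ p , remQuot {l} m (proj₂ p)) (remQuot-combine i (combine j o)))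
  (cong (i ,_) (remQuot-combine j o))

enum-pad : ∀ {A m n} → A → m ≤ n → Enumeration A m → Enumeration A n
enum-pad {A} {m} {n} x₀ m≤n e = record
  { enum = at ; index = λ x → inject≤ (index e x) m≤n ; enum-index = λ x → at-inject x }
  where
  at : Fin n → A
  at i with toℕ i <? m
  ... | yes lt = enum e (fromℕ< lt)
  ... | no _   = x₀
  at-inject : ∀ x → at (inject≤ (index e x) m≤n) ≡ x
  at-inject x with toℕ (inject≤ (index e x) m≤n) <? m
  ... | yes lt = trans (cong (enum e) (toℕ-injective (trans (toℕ-fromℕ< lt) (toℕ-inject≤ (index e x) m≤n)))) (enum-index e x)
  ... | no nlt = ⊥-elim (nlt (subst (_< m) (≡-sym (toℕ-inject≤ (index e x) m≤n)) (toℕ<n (index e x))))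

enum-Pat : ∀ {a b} (E : RBE a b) {s} → sizeE E ≤ s → Enumeration (Pat E) (2 ^ s)
enum-Pat E {s} le = enum-pad (bot E) (2^-mono le) (exact E)
  where
  exact : ∀ {a b} (E : RBE a b) → Enumeration (Pat E) (2 ^ sizeE E)
  pair : ∀ {a b} (E F : RBE a b) → Enumeration (Pat E × Pat F) (2 ^ suc (sizeE E + sizeE F))
  exact ε        = enum-pad tt (s≤s z≤n) enum-⊤
  exact (sym _)  = enum-pad tt (s≤s z≤n) enum-⊤
  exact (E ∣ F)  = pair E F
  exact (E ∥ F)  = pair E F
  exact (E ^ᴵ I) = enum-pad (false , bot E) (2^-mono (s≤s (m≤m+n (sizeE E) (sizeI I)))) (enum-× enum-Bool (exact E))
  pair E F = enum-pad (bot E , bot F)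
    (≤-trans (≤-reflexive (≡-sym (^-distribˡ-+-* 2 (sizeE E) (sizeE F)))) (2^-mono (n≤1+n (sizeE E + sizeE F))))
    (enum-× (exact E) (exact F))

-- The digits are redundant, and large wherever x is not zero: this is what makes every flow for 2 x + d the sum
-- of twice a flow for x and a flow for d.
Digits : ∀ {m} → ℕ → (Fin m → ℕ) → (Fin m → ℕ) → Set
Digits D x d = (∀ c → x c ≡ 0 ⊎ D ≤ d c) × (∀ c → d c ≤ suc D)

-- A finite automaton that reads vectors digit by digit, most significant digit first, and recognises the
-- sets acc α; its state after reading x is the set of all i such that V x i.
record Recognizer {m} (D : ℕ) {A : Set} (acc : A → (Fin m → ℕ) → Set) (n : ℕ) : Set₁ where
  field
    V     : (Fin m → ℕ) → Fin n → Set
    V-ext : ∀ {x y} → x ≗ y → ∀ i → V x i → V y i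

  infix 4 _⊑_
  _⊑_ : (Fin m → ℕ) → (Fin m → ℕ) → Set
  x ⊑ y = ∀ i → V x i → V y i

  field
    step   : ∀ {x y d} → Digits D x d → x ⊑ y → (λ c → 2 * x c + d c) ⊑ (λ c → 2 * y c + d c)
    accept : ∀ {x y} → x ⊑ y → ∀ α → acc α x → acc α y

module _ {m D : ℕ} where

  recognizer-family : ∀ {k n} {acc : Fin k → (Fin m → ℕ) → Set} →
                      (∀ t → Recognizer D {⊤} (λ _ → acc t) n) → Recognizer D acc (k * n)
  recognizer-family {k} {n} {acc} R = record
    { V = λ x i → R.V (proj₁ (remQuot {k} n i)) x (proj₂ (remQuot {k} n i))
    ; V-ext = λ e i → R.V-ext (proj₁ (remQuot {k} n i)) e (proj₂ (remQuot {k} n i))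
    ; step = λ ds h i → R.step (proj₁ (remQuot {k} n i)) ds (at h (proj₁ (remQuot {k} n i))) (proj₂ (remQuot {k} n i))
    ; accept = λ h t → R.accept t (at h t) tt }
    where
    module R t = Recognizer (R t)
    at : ∀ {x y} → (∀ i → R.V (proj₁ (remQuot {k} n i)) x (proj₂ (remQuot {k} n i)) → R.V (proj₁ (remQuot {k} n i)) y (proj₂ (remQuot {k} n i))) →
         ∀ t j → R.V t x j → R.V t y j
    at {x} {y} h t j = subst (λ p → R.V (proj₁ p) x (proj₂ p) → R.V (proj₁ p) y (proj₂ p)) (remQuot-combine t j) (h (combine t j))

  recognizer-⊎ : ∀ {A B n k} {acc : A → (Fin m → ℕ) → Set} {acc' : B → (Fin m → ℕ) → Set} →
                 Recognizer D acc n → Recognizer D acc' k → Recognizer D [ acc , acc' ] (n + k)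
  recognizer-⊎ {n = n} {k} R S = record
    { V = λ x i → [ R.V x , S.V x ] (splitAt n i)
    ; V-ext = λ e i → ext e (splitAt n i)
    ; step = λ ds h i → both (R.step ds (left h)) (S.step ds (right h)) (splitAt n i)
    ; accept = λ h → λ { (inj₁ α) → R.accept (left h) α ; (inj₂ α) → S.accept (right h) α } }
    where
    module R = Recognizer R
    module S = Recognizer S
    ext : ∀ {x y} → x ≗ y → ∀ s → [ R.V x , S.V x ] s → [ R.V y , S.V y ] s
    ext e (inj₁ i) = R.V-ext e i
    ext e (inj₂ i) = S.V-ext e i
    both : ∀ {x y} → x R.⊑ y → x S.⊑ y → ∀ s → [ R.V x , S.V x ] s → [ R.V y , S.V y ] s
    both f g (inj₁ i) = f i
    both f g (inj₂ i) = g i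
    left : ∀ {x y} → (∀ i → [ R.V x , S.V x ] (splitAt n i) → [ R.V y , S.V y ] (splitAt n i)) → x R.⊑ y
    left {x} {y} h i = subst (λ s → [ R.V x , S.V x ] s → [ R.V y , S.V y ] s) (splitAt-↑ˡ n i k) (h (i ↑ˡ k))
    right : ∀ {x y} → (∀ i → [ R.V x , S.V x ] (splitAt n i) → [ R.V y , S.V y ] (splitAt n i)) → x S.⊑ y
    right {x} {y} h i = subst (λ s → [ R.V x , S.V x ] s → [ R.V y , S.V y ] s) (splitAt-↑ʳ n k i) (h (n ↑ʳ i))

module _ {a b : ℕ} where

  Accepts : ∀ {m} → RBE a b → (Fin m → Fin a × (Fin b → Bool)) → (Fin m → ℕ) → Set
  Accepts E τ x = ∃ λ w → Flow τ x w × ⟦ E ⟧ w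

  accepts-dec : ∀ {m} E (τ : Fin m → Fin a × (Fin b → Bool)) x → Dec (Accepts E τ x)
  accepts-dec E τ x = finite-∃? (flow-finite τ x) (⟦⟧-ext E) (⟦⟧-dec E)

  flow-cong : ∀ {m} (τ : Fin m → Fin a × (Fin b → Bool)) {x y} → x ≗ y → Flow τ x ⊆ Flow τ y
  flow-cong τ e = ΣL-mono (λ c {w} → subst (λ k → powL (Pick (proj₁ (τ c)) (proj₂ (τ c))) k w) (e c))

  accepts-ext : ∀ {m} E (τ : Fin m → Fin a × (Fin b → Bool)) {x y} → x ≗ y → Accepts E τ x → Accepts E τ y
  accepts-ext E τ {x} {y} e (w , p , q) = w , flow-cong τ {x} {y} e p , q

  %2-cong : ∀ {m n x y} → 2 * x + m ≡ 2 * y + n → m % 2 ≡ n % 2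
  %2-cong {m} {n} {x} {y} e = trans (≡-sym (drop m x)) (trans (cong (_% 2) e) (drop n y))
    where
    drop : ∀ m x → (2 * x + m) % 2 ≡ m % 2
    drop m x = trans (cong (_% 2) (trans (+-comm (2 * x) m) (cong (m +_) (*-comm 2 x)))) ([m+kn]%n≡m%n m x 2)

  module _ {m : ℕ} (τ : Fin m → Fin a × (Fin b → Bool)) (E : RBE a b) (D : ℕ) (b≤D : b ≤ D) where

    -- The residual condition on w ∈ Flow τ x left over from a condition w ∈ Basic E U + Periods E U on the
    -- bag that is obtained from w by appending digits.
    Residual : (Fin m → ℕ) → Bag a b → Bag a b → Pat E → Set
    Residual x u v U = ∃₂ λ w p → Flow τ x w × Periods E U p × w ⊕ u ≗ v ⊕ p

    residual-ext : ∀ {x u u' v v' U} → u ≗ u' → v ≗ v' → Residual x u v U → Residual x u' v' U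
    residual-ext e f (w , p , q , r , h) = w , p , q , r , λ z → trans (cong (w z +_) (≡-sym (e z))) (trans (h z) (cong (_+ p z) (f z)))

    module _ (C : ℕ) (γ≤C : γ E ≤ C) (β≤C : β E ≤ C) where

      -- A digit vector has `m` entries of at most `suc D`, and each edge contributes at most 1 to
      -- an entry of a flow.
      R : ℕ
      R = m * suc D

      _≼_ : (Fin m → ℕ) → (Fin m → ℕ) → Set
      x ≼ y = ∀ u v U → (∀ z → u z ≤ R) → (∀ z → v z ≤ C) → Residual x u v U → Residual y u v U

      half≤bound : ∀ {k i j} → i ≤ k → j ≤ k → ⌊ i + j /2⌋ ≤ k
      half≤bound {k} p q = ≤-trans (⌊n/2⌋-mono (+-mono-≤ p q)) (≤-reflexive (≡-sym (n≡⌊n+n/2⌋ k)))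

      -- With `w = 2 w' + r` and `p = 2 p' + f`, the equation `w + u = v + p` forces `r + u` and
      -- `v + f` to have equal parity, so it can be halved, the rounded halves being the new `u` and
      -- `v`. These are averages of numbers within `R` and within `C`, so the bounds reproduce
      -- themselves. On the way back, the same `r` and `f` are appended to a solution for `y`. The
      -- digit condition concerns `x`, whose flow is split; flows for `y` are composed.
      residual-step : ∀ {x y d} → Digits D x d → x ≼ y → (λ c → 2 * x c + d c) ≼ (λ c → 2 * y c + d c)
      residual-step {x} {y} {d} (ok , small) h u v U u≤ v≤ (w , p , fw , pp , e) =
        go (flow-halve τ x d (λ c → enough (ok c)) fw) (periods-halve E U pp)
        where
        enough : ∀ {k l} → k ≡ 0 ⊎ D ≤ l → k ≡ 0 ⊎ b ≤ suc l
        enough (inj₁ z) = inj₁ z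
        enough (inj₂ l) = inj₂ (≤-trans b≤D (≤-trans l (n≤1+n _)))
        go : (∃₂ λ w' r → w ≗ (twice w' plus r) × Flow τ x w' × Flow τ d r) →
             (∃₂ λ p' f → p ≗ (twice p' plus f) × Periods E U p' × Capped (Periods E U) (γ E) f) →
             Residual (λ c → 2 * y c + d c) u v U
        go (w' , r , ew , fw' , fr) (p' , f , ep , pp' , (pf , f≤)) = back (h u' v' U
            (λ z → half≤bound (flow-bounded τ d small fr z) (u≤ z)) (λ z → half≤bound (v≤ z) (≤-trans (f≤ z) γ≤C))
            (w' , p' , fw' , pp' , λ z → *-cancelˡ-≡ _ _ 2 (balance z)))
          where
          u' v' : Bag a b
          u' z = ⌊ r z + u z /2⌋
          v' z = ⌊ v z + f z /2⌋
          whole : ∀ z → 2 * w' z + (r z + u z) ≡ 2 * p' z + (v z + f z)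
          whole z = begin
            2 * w' z + (r z + u z)   ≡⟨ ≡-sym (+-assoc (2 * w' z) (r z) (u z)) ⟩
            2 * w' z + r z + u z     ≡⟨ cong (_+ u z) (≡-sym (ew z)) ⟩
            w z + u z                ≡⟨ e z ⟩
            v z + p z                ≡⟨ cong (v z +_) (ep z) ⟩
            v z + (2 * p' z + f z)   ≡⟨ x∙yz≈y∙xz (v z) (2 * p' z) (f z) ⟩
            2 * p' z + (v z + f z)   ∎
            where open ≡-Reasoning
          bits≡ : ∀ z → (r z + u z) % 2 ≡ (v z + f z) % 2
          bits≡ z = %2-cong {x = w' z} {p' z} (whole z)
          split : ∀ n → n ≡ 2 * ⌊ n /2⌋ + n % 2
          split n = trans (m≡m%n+[m/n]*n n 2) (trans (+-comm (n % 2) _) (cong (_+ n % 2) (trans (*-comm (n / 2) 2) (cong (2 *_) (≡-sym (⌊n/2⌋≡n/2 n))))))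
            where
            ⌊n/2⌋≡n/2 : ∀ n → ⌊ n /2⌋ ≡ n / 2
            ⌊n/2⌋≡n/2 zero          = refl
            ⌊n/2⌋≡n/2 (suc zero)    = refl
            ⌊n/2⌋≡n/2 (suc (suc n)) = trans (cong suc (⌊n/2⌋≡n/2 n)) (≡-sym ([n+m]/n≡1+m/n n))
              where
              [n+m]/n≡1+m/n : ∀ n → (2 + n) / 2 ≡ suc (n / 2)
              [n+m]/n≡1+m/n n = +-distrib-/-∣ˡ {2} n {2} (divides 1 refl)
          balance : ∀ z → 2 * (w' z + u' z) ≡ 2 * (v' z + p' z)
          balance z = +-cancelʳ-≡ ((r z + u z) % 2) _ _ (begin
            2 * (w' z + u' z) + (r z + u z) % 2      ≡⟨ lem (w' z) (u' z) _ ⟩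
            2 * w' z + (2 * u' z + (r z + u z) % 2)  ≡⟨ cong (2 * w' z +_) (≡-sym (split (r z + u z))) ⟩
            2 * w' z + (r z + u z)                   ≡⟨ whole z ⟩
            2 * p' z + (v z + f z)                   ≡⟨ cong (2 * p' z +_) (split (v z + f z)) ⟩
            2 * p' z + (2 * v' z + (v z + f z) % 2)  ≡⟨ lem' (p' z) (v' z) _ ⟩
            2 * (v' z + p' z) + (v z + f z) % 2      ≡⟨ cong (2 * (v' z + p' z) +_) (≡-sym (bits≡ z)) ⟩
            2 * (v' z + p' z) + (r z + u z) % 2      ∎)
            where
            open ≡-Reasoning
            lem : ∀ i j k → 2 * (i + j) + k ≡ 2 * i + (2 * j + k)
            lem = solve-∀
            lem' : ∀ i j k → 2 * i + (2 * j + k) ≡ 2 * (j + i) + k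
            lem' = solve-∀
          back : Residual y u' v' U → Residual (λ c → 2 * y c + d c) u v U
          back (w″ , p″ , fw″ , pp″ , e″) = (twice w″ plus r) , (twice p″ plus f) ,
            flow-double τ y d fw″ fr , periods-double E U pp″ pf , λ z → begin
              2 * w″ z + r z + u z                       ≡⟨ +-assoc (2 * w″ z) (r z) (u z) ⟩
              2 * w″ z + (r z + u z)                     ≡⟨ cong (2 * w″ z +_) (split (r z + u z)) ⟩
              2 * w″ z + (2 * u' z + (r z + u z) % 2)    ≡⟨ ≡-sym (lem (w″ z) (u' z) _) ⟩
              2 * (w″ z + u' z) + (r z + u z) % 2        ≡⟨ cong₂ (λ i j → 2 * i + j) (e″ z) (bits≡ z) ⟩
              2 * (v' z + p″ z) + (v z + f z) % 2        ≡⟨ lem' (v' z) (p″ z) _ ⟩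
              2 * p″ z + (2 * v' z + (v z + f z) % 2)    ≡⟨ cong (2 * p″ z +_) (≡-sym (split (v z + f z))) ⟩
              2 * p″ z + (v z + f z)                     ≡⟨ x∙yz≈y∙xz (2 * p″ z) (v z) (f z) ⟩
              v z + (2 * p″ z + f z)                     ∎
            where
            open ≡-Reasoning
            lem : ∀ i j k → 2 * (i + j) + k ≡ 2 * i + (2 * j + k)
            lem = solve-∀
            lem' : ∀ i j k → 2 * (i + j) + k ≡ 2 * j + (2 * i + k)
            lem' = solve-∀

      -- By `complete` and `sound`, acceptance means that some residual condition holds with empty
      -- `u` and with a basic bag of pattern `U` as `v`.
      residual-accept : ∀ {x y} → x ≼ y → Accepts E τ x → Accepts E τ y
      residual-accept {x} {y} h (w , fw , ew) = start (complete E ew)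
        where
        start : (∃ λ U → Rep E U w) → Accepts E τ y
        start (U , v , p , bv , pp , e) = finish (h 𝟘 v U (λ _ → z≤n) (λ z → ≤-trans (basic-bounded E U bv z) β≤C)
            (w , p , fw , pp , λ z → trans (+-identityʳ (w z)) (e z)))
          where
          finish : Residual y 𝟘 v U → Accepts E τ y
          finish (w' , p' , fw' , pp' , e') = w' , fw' ,
            ⟦⟧-ext E (λ z → trans (≡-sym (e' z)) (+-identityʳ (w' z))) (sound E U bv pp')

      module _ {s : ℕ} (size≤s : sizeE E ≤ s) where

        StateCount : ℕ
        StateCount = BagCode {a} {b} R * (BagCode {a} {b} C * 2 ^ s)

        At : (Fin m → ℕ) → Fin (BagCode {a} {b} R) × Fin (BagCode {a} {b} C) × Fin (2 ^ s) → Set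
        At x (i , j , k) = Residual x (bagOf R i) (bagOf C j) (enum (enum-Pat E size≤s) k)

        states-≼ : ∀ {x y} → (∀ i → At x (triple i) → At y (triple i)) → x ≼ y
        states-≼ {x} {y} h u v U hu hv r =
          residual-ext {y} (bagOf-codeOf R u hu) (bagOf-codeOf C v hv)
            (subst (Residual y (bagOf R i) (bagOf C j)) U≡
              (subst (λ t → At x t → At y t) (triple-untriple i j k) (h (untriple i j k))
                (subst (Residual x (bagOf R i) (bagOf C j)) (≡-sym U≡)
                  (residual-ext {x} (λ z → ≡-sym (bagOf-codeOf R u hu z)) (λ z → ≡-sym (bagOf-codeOf C v hv z)) r))))
          where
          i = codeOf R u hu
          j = codeOf C v hv
          k = index (enum-Pat E size≤s) U
          U≡ = enum-index (enum-Pat E size≤s) U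

        ≼-states : ∀ {x y} → x ≼ y → ∀ i → At x (triple i) → At y (triple i)
        ≼-states h i = h _ _ _ (bagOf≤ R _) (bagOf≤ C _)

        rbe-recognizer : Recognizer D {⊤} (λ _ → Accepts E τ) StateCount
        rbe-recognizer = record
          { V = λ x i → At x (triple i)
          ; V-ext = λ { {x} {y} e i (w , p , q , r) → w , p , flow-cong τ {x} {y} e q , r }
          ; step = λ {x} {y} {d} ds h → ≼-states {λ c → 2 * x c + d c} {λ c → 2 * y c + d c} (residual-step {x} {y} ds (states-≼ {x} {y} h))
          ; accept = λ {x} {y} h _ → residual-accept {x} {y} (states-≼ {x} {y} h) }

-- Pumping

iterate-half : ∀ {m} → ℕ → ℕ → (Fin m → ℕ) → Fin m → ℕ
iterate-half D zero    x = x
iterate-half D (suc j) x = iterate-half D j (λ c → half D (x c))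

iterate-half-suc : ∀ {m} D j (x : Fin m → ℕ) c → iterate-half D (suc j) x c ≡ half D (iterate-half D j x c)
iterate-half-suc D zero    x c = refl
iterate-half-suc D (suc j) x c = iterate-half-suc D j (λ c → half D (x c)) c

iterate-half-anti : ∀ {m} D {i j} (x : Fin m → ℕ) c → i ≤ j → iterate-half D j x c ≤ iterate-half D i x c
iterate-half-anti D {i} {j} x c i≤j = go (≤⇒≤′ i≤j)
  where
  go : ∀ {j} → i ≤′ j → iterate-half D j x c ≤ iterate-half D i x c
  go (≤′-reflexive refl) = ≤-refl
  go (≤′-step {n} h)     = ≤-trans (≤-reflexive (iterate-half-suc D n x c)) (≤-trans (half≤ D _) (go h))

n≤2*half+1+D : ∀ D n → n ≤ 2 * half D n + suc D
n≤2*half+1+D D n = ≤-trans (≤-reflexive (≡-sym (half-digit D n))) (+-monoʳ-≤ (2 * half D n) (digit≤ D n))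

iterate-half-bound : ∀ {m} D j (x : Fin m → ℕ) c → iterate-half D j x c ≡ 0 → x c ≤ suc D * 2 ^ j
iterate-half-bound D j x c e = ≤-trans (m≤m+n (x c) (suc D)) (strong j x e)
  where
  open ≤-Reasoning
  -- The additional `suc D` makes the induction close: `n + suc D` is at most twice
  -- `half D n + suc D`.
  strong : ∀ j x → iterate-half D j x c ≡ 0 → x c + suc D ≤ suc D * 2 ^ j
  strong zero    x e = ≤-reflexive (trans (cong (_+ suc D) e) (≡-sym (*-identityʳ (suc D))))
  strong (suc j) x e = begin
    x c + suc D                          ≤⟨ +-monoˡ-≤ (suc D) (n≤2*half+1+D D (x c)) ⟩
    2 * half D (x c) + suc D + suc D     ≡⟨ lem (half D (x c)) (suc D) ⟩
    2 * (half D (x c) + suc D)           ≤⟨ *-monoʳ-≤ 2 (strong j (λ c → half D (x c)) e) ⟩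
    2 * (suc D * 2 ^ j)                  ≡⟨ lem' (suc D) (2 ^ j) ⟩
    suc D * 2 ^ suc j                    ∎
    where
    lem : ∀ x y → 2 * x + y + y ≡ 2 * (x + y)
    lem = solve-∀
    lem' : ∀ x y → 2 * (x * y) ≡ x * (2 * y)
    lem' = solve-∀

Fin-¬¬ : ∀ {n} {P : Fin n → Set} → (∀ i → ¬ ¬ P i) → ¬ ¬ (∀ i → P i)
Fin-¬¬ {zero}  f k = k (λ ())
Fin-¬¬ {suc n} f k = f zero λ p → Fin-¬¬ (λ i → f (suc i)) λ q → k λ { zero → p ; (suc i) → q i }

bool→Fin : Bool → Fin 2
bool→Fin false = zero
bool→Fin true  = suc zero

does-transfer : ∀ {P Q : Set} (p : Dec P) (q : Dec Q) → bool→Fin (does p) ≡ bool→Fin (does q) → P → Q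
does-transfer _       (yes q) _ _ = q
does-transfer (yes _) (no _) () _
does-transfer (no ¬p) (no _) _ p = ⊥-elim (¬p p)

bounded-∃fun? : ∀ {m} {P : (Fin m → ℕ) → Set} → (∀ {x y} → x ≗ y → P x → P y) → (∀ x → Dec (P x)) → ∀ k →
                Dec (∃ λ x → (∀ c → x c ≤ k) × P x)
bounded-∃fun? {m} {P} ext P? k = map′
  (λ { (i , p) → at i , (λ c → ≤-pred (toℕ<n (finToFun {suc k} {m} i c))) , p })
  (λ { (x , h , p) → funToFin {m} (λ c → fromℕ< {x c} (s≤s (h c))) , ext (λ c → ≡-sym (trans
    (cong toℕ (finToFun-funToFin {m} (λ c → fromℕ< {x c} (s≤s (h c))) c)) (toℕ-fromℕ< (s≤s (h c))))) p })
  (any? (λ i → P? (at i)))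
  where
  at : Fin (suc k ^ m) → Fin m → ℕ
  at i c = toℕ (finToFun {suc k} {m} i c)

module _ {m D n : ℕ} {A : Set} {acc : A → (Fin m → ℕ) → Set} (R : Recognizer D acc n) where

  open Recognizer R

  pumpBound : ℕ
  pumpBound = suc D * 2 ^ (2 ^ n)

  ⊑-refl : ∀ {x} → x ⊑ x
  ⊑-refl i p = p

  ⊑-trans : ∀ {x y z} → x ⊑ y → y ⊑ z → x ⊑ z
  ⊑-trans f g i p = g i (f i p)

  rebuilt : ∀ (x : Fin m → ℕ) → (λ c → 2 * half D (x c) + digit D (x c)) ≗ x
  rebuilt x c = half-digit D (x c)

  record Below (x y : Fin m → ℕ) : Set where
    field
      below : ∀ c → y c ≤ x c
      x⊑y   : x ⊑ y
      y⊑x   : y ⊑ x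

  open Below

  -- The last `j` digits of `x` are appended to the replacement `y` of its leading part. Since
  -- `step` is applied in both directions, these digits must be legal after the smaller vector too;
  -- `below` secures this, as a vanishing half forces a vanishing replacement.
  append-digits : ∀ j x y → Below (iterate-half D j x) y →
                  ∃ λ z → Below x z × (∀ c → y c < iterate-half D j x c → z c < x c)
  append-digits zero    x y h = y , h , λ c lt → lt
  append-digits (suc j) x y h = extend (append-digits j (λ c → half D (x c)) y h)
    where
    d = λ c → digit D (x c)
    extend : (∃ λ z → Below (λ c → half D (x c)) z × (∀ c → y c < iterate-half D (suc j) x c → z c < half D (x c))) →
             ∃ λ z → Below x z × (∀ c → y c < iterate-half D (suc j) x c → z c < x c)
    extend (z , b , s) = (λ c → 2 * z c + d c) , record
      { below = λ c → ≤-trans (+-monoˡ-≤ (d c) (*-monoʳ-≤ 2 (below b c))) (≤-reflexive (rebuilt x c))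
      ; x⊑y = ⊑-trans {x} {λ c → 2 * half D (x c) + d c} {λ c → 2 * z c + d c} (V-ext (λ c → ≡-sym (rebuilt x c)))
          (step ((λ c → ≤digit D (x c)) , λ c → digit≤ D (x c)) (x⊑y b))
      ; y⊑x = ⊑-trans {λ c → 2 * z c + d c} {λ c → 2 * half D (x c) + d c} {x}
          (step ((λ c → small c (≤digit D (x c))) , λ c → digit≤ D (x c)) (y⊑x b)) (V-ext (rebuilt x)) } ,
      λ c lt → ≤-trans (+-monoˡ-< (d c) (*-monoʳ-< 2 (s c lt))) (≤-reflexive (rebuilt x c))
      where
      small : ∀ c → half D (x c) ≡ 0 ⊎ D ≤ d c → z c ≡ 0 ⊎ D ≤ d c
      small c (inj₁ e) = inj₁ (n≤0⇒n≡0 (subst (z c ≤_) e (below b c)))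
      small c (inj₂ l) = inj₂ l

  below-trans : ∀ {x y z} → Below x y → Below y z → Below x z
  below-trans {x} {y} {z} p q = record
    { below = λ c → ≤-trans (below q c) (below p c) ; x⊑y = ⊑-trans {x} {y} {z} (x⊑y p) (x⊑y q) ; y⊑x = ⊑-trans {z} {y} {x} (y⊑x q) (y⊑x p) }

  -- A vector with more than 2 ^ n digits passes through some state twice, and the digits in between can be cut out.
  cut : ∀ x c → iterate-half D (2 ^ n) x c ≢ 0 → ¬ ¬ (∃ λ y → Below x y × sum y < sum x)
  -- The predicate `V` comes without a decision procedure. The goal is doubly negated, so the
  -- finitely many memberships that the pigeonhole principle compares may be assumed decided.
  cut x c long k = Fin-¬¬ (λ (j : Fin (suc (2 ^ n))) → Fin-¬¬ (λ i → ¬¬-excluded-middle {A = V (iterate-half D (toℕ j) x) i}))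
    λ V? → k (repeat V? (pigeonhole ≤-refl (code V?)))
    where
    xs : Fin (suc (2 ^ n)) → Fin m → ℕ
    xs j = iterate-half D (toℕ j) x
    code : (∀ j i → Dec (V (xs j) i)) → Fin (suc (2 ^ n)) → Fin (2 ^ n)
    code V? j = funToFin (λ i → bool→Fin (does (V? j i)))
    same : ∀ V? {i j} → code V? i ≡ code V? j → xs i ⊑ xs j
    same V? {i} {j} e q = does-transfer (V? i q) (V? j q)
      (trans (≡-sym (finToFun-funToFin (λ q → bool→Fin (does (V? i q))) q))
        (trans (cong (λ p → finToFun p q) e) (finToFun-funToFin (λ q → bool→Fin (does (V? j q))) q)))
    repeat : ∀ V? → (∃₂ λ i j → toℕ i < toℕ j × code V? i ≡ code V? j) → ∃ λ y → Below x y × sum y < sum x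
    repeat V? (i , j , i<j , e) = finish (append-digits (toℕ i) x (xs j) (record
      { below = λ c → iterate-half-anti D x c (<⇒≤ i<j) ; x⊑y = same V? e ; y⊑x = same V? (≡-sym e) }))
      where
      positive : 0 < xs i c
      positive = ≤-trans (n≢0⇒n>0 long) (iterate-half-anti D x c (≤-pred (toℕ<n i)))
      shorter : xs j c < xs i c
      shorter = ≤-trans (s≤s (iterate-half-anti D x c i<j))
        (≤-trans (s≤s (≤-reflexive (iterate-half-suc D (toℕ i) x c))) (half< D (xs i c) positive))
      finish : (∃ λ z → Below x z × (∀ c → xs j c < xs i c → z c < x c)) → ∃ λ y → Below x y × sum y < sum x
      finish (z , b , s) = z , b , sum-mono-< (below b) c (s c shorter)

  pump : ∀ x → ¬ ¬ (∃ λ y → Below x y × (∀ c → y c ≤ pumpBound))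
  pump x = go x (<-wellFounded (sum x))
    where
    go : ∀ x → Acc _<_ (sum x) → ¬ ¬ (∃ λ y → Below x y × (∀ c → y c ≤ pumpBound))
    go x (wf rec) with all? (λ c → iterate-half D (2 ^ n) x c ≟ 0)
    ... | yes short = λ k → k (x , record { below = λ c → ≤-refl ; x⊑y = ⊑-refl {x} ; y⊑x = ⊑-refl {x} } ,
            λ c → iterate-half-bound D (2 ^ n) x c (short c))
    ... | no ¬short with ¬∀⟶∃¬ m _ (λ c → iterate-half D (2 ^ n) x c ≟ 0) ¬short
    ... | c , long = λ k → cut x c long λ { (y , b , lt) → go y (rec lt) λ { (z , b' , bd) → k (z , below-trans b b' , bd) } }

  -- The double negation of `pump` is removed here: once `⊑` is replaced by its consequences for the
  -- decidable `acc`, the existence of `y` can be settled by a bounded search. The bound `y c ≤ x c`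
  -- keeps empty classes empty.
  shrink : (∀ {P : A → Set} → (∀ α → Dec (P α)) → Dec (∀ α → P α)) →
           (∀ α {x y} → x ≗ y → acc α x → acc α y) → (∀ α x → Dec (acc α x)) → ∀ x →
           ∃ λ y → (∀ c → y c ≤ pumpBound) × (∀ c → y c ≤ x c) × (∀ α → acc α x → acc α y) × (∀ α → acc α y → acc α x)
  shrink ∀A? ext acc? x = decidable-stable
    (bounded-∃fun?
      (λ e (p , q , r) → (λ c → ≤-trans (≤-reflexive (≡-sym (e c))) (p c)) , (λ α a → ext α e (q α a)) , (λ α a → r α (ext α (λ c → ≡-sym (e c)) a)))
      (λ y → all? (λ c → y c ≤? x c) ×-dec ∀A? (λ α → acc? α x →-dec acc? α y) ×-dec ∀A? (λ α → acc? α y →-dec acc? α x))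
      pumpBound)
    λ k → pump x λ { (y , b , bd) → k (y , bd , below b , accept (x⊑y b) , accept (y⊑x b)) }

-- Signatures and typings of graphs

pick-disj : ∀ {nΣ} (S : Schema nΣ) (G : CGraph nΣ) l (B : Fin (Schema.nT S) → Bool) {w} →
            disjL S G (map (l ,_) (filter (λ t → B t Bool.≟ true) (allFin (Schema.nT S)))) w → Pick l B w
pick-disj S G l B p with go (filter (λ t → B t Bool.≟ true) (allFin (Schema.nT S))) p
  where
  go : ∀ ts {w} → disjL S G (map (l ,_) ts) w → ∃ λ t → t ∈ ts × singleL (l , t) w
  go (t ∷ ts) (inj₁ p) = t , here refl , p
  go (t ∷ ts) (inj₂ p) with go ts p
  ... | t' , m , q = t' , there m , q
... | t , m , q = t , proj₂ (∈-filter⁻ (λ t → B t Bool.≟ true) {xs = allFin (Schema.nT S)} m) , q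

disj-pick : ∀ {nΣ} (S : Schema nΣ) (G : CGraph nΣ) l (B : Fin (Schema.nT S) → Bool) {w} →
            Pick l B w → disjL S G (map (l ,_) (filter (λ t → B t Bool.≟ true) (allFin (Schema.nT S)))) w
disj-pick S G l B (t , e , q) = go (∈-filter⁺ (λ t → B t Bool.≟ true) (∈-allFin t) e) q
  where
  go : ∀ {ts w} → t ∈ ts → singleL (l , t) w → disjL S G (map (l ,_) ts) w
  go (here refl) q = inj₁ q
  go (there m)   q = inj₂ (go m q)

pick-mono : ∀ {a b} {l l' : Fin a} {B B' : Fin b → Bool} → l ≡ l' → (∀ t → B t ≡ true → B' t ≡ true) → Pick l B ⊆ Pick l' B'
pick-mono refl h (t , e , q) = t , h t e , q

pow-mono-pos : ∀ {a b} {L M : Lang a b} i → (0 < i → L ⊆ M) → powL L i ⊆ powL M i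
pow-mono-pos zero    f p = p
pow-mono-pos {L = L} {M} (suc i) f p = pow-mono {L = L} {M} (f (s≤s z≤n)) (suc i) p

module _ {a b m : ℕ} (D : Fin m → Lang a b) where

  bump : Fin m → ℕ → (Fin m → ℕ) → Fin m → ℕ
  bump c₀ k x c = (if does (c₀ ≟ᶠ c) then k else 0) + x c

  ΣPow : (Fin m → ℕ) → Lang a b
  ΣPow x = ΣL (λ c → powL (D c) (x c))

module _ {a b : ℕ} where

  ΣPow-bump : ∀ {m} (D : Fin m → Lang a b) c₀ k x → (powL (D c₀) k ⊎L ΣPow D x) ⊆ ΣPow D (bump D c₀ k x)
  ΣPow-bump D zero k x (u , v , p , (s , t , q , q' , h') , h) = u ⊕ s , t , pow-add (D zero) k (x zero) p q , q' ,
    λ z → trans (h z) (trans (cong (u z +_) (h' z)) (≡-sym (+-assoc (u z) (s z) (t z))))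
  ΣPow-bump D (suc c₀) k x (u , v , p , (s , t , q , q' , h') , h) = s , u ⊕ t , q ,
    ΣPow-bump (D ∘ suc) c₀ k (x ∘ suc) (u , t , p , q' , λ _ → refl) ,
    λ z → trans (h z) (trans (cong (u z +_) (h' z)) (x∙yz≈y∙xz (u z) (s z) (t z)))

  ΣPow-unbump : ∀ {m} (D : Fin m → Lang a b) c₀ k x → ΣPow D (bump D c₀ k x) ⊆ (powL (D c₀) k ⊎L ΣPow D x)
  ΣPow-unbump D zero k x (u , v , p , q , h) with pow-split (D zero) k (x zero) p
  ... | s , t , ps , pt , e = s , t ⊕ v , ps , (t , v , pt , q , λ _ → refl) ,
        λ z → trans (h z) (trans (cong (_+ v z) (e z)) (+-assoc (s z) (t z) (v z)))
  ΣPow-unbump D (suc c₀) k x (u , v , p , q , h) with ΣPow-unbump (D ∘ suc) c₀ k (x ∘ suc) q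
  ... | s , t , ps , pt , e = s , u ⊕ t , ps , (u , t , p , pt , λ _ → refl) ,
        λ z → trans (h z) (trans (cong (u z +_) (e z)) (x∙yz≈y∙xz (u z) (s z) (t z)))

module _ {A : Set} {m : ℕ} (cls : A → Fin m) (occ : A → ℕ) where

  count : List A → Fin m → ℕ
  count []       c = 0
  count (e ∷ es) c = (if does (cls e ≟ᶠ c) then occ e else 0) + count es c

  count≢0 : ∀ es c → 0 < count es c → ∃ λ e → e ∈ es × cls e ≡ c
  count≢0 (e ∷ es) c p with cls e ≟ᶠ c
  ... | yes eq = e , here refl , eq
  ... | no _ with count≢0 es c p
  ... | e' , m , eq = e' , there m , eq

  module _ {a b : ℕ} (D : Fin m → Lang a b) (f : A → Lang a b) where

    -- Bag union is associative and commutative, so the edges can be grouped by class, and within a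
    -- class the exponents add.
    gather : ∀ es → (∀ {e} → e ∈ es → f e ⊆ powL (D (cls e)) (occ e)) →
             foldr _⊎L_ emptyBagL (map f es) ⊆ ΣPow D (count es)
    gather []       h p = empties D p
      where
      empties : ∀ {m} (D : Fin m → Lang a b) → emptyBagL ⊆ ΣPow D (λ _ → 0)
      empties {zero}  D p = p
      empties {suc m} D {w} p = 𝟘 , w , (λ _ → refl) , empties (D ∘ suc) p , λ _ → refl
    gather (e ∷ es) h (u , v , p , q , eq) =
      ΣPow-bump D (cls e) (occ e) (count es) (u , v , h (here refl) p , gather es (h ∘ there) q , eq)

    scatter : ∀ es → (∀ {e} → e ∈ es → powL (D (cls e)) (occ e) ⊆ f e) →
              ΣPow D (count es) ⊆ foldr _⊎L_ emptyBagL (map f es)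
    scatter []       h p = empties D p
      where
      empties : ∀ {m} (D : Fin m → Lang a b) → ΣPow D (λ _ → 0) ⊆ emptyBagL
      empties {zero}  D p = p
      empties {suc m} D (u , v , p , q , h) z = trans (h z) (cong₂ _+_ (p z) (empties (D ∘ suc) q z))
    scatter (e ∷ es) h p with ΣPow-unbump D (cls e) (occ e) (count es) p
    ... | u , v , q , q' , eq = u , v , h (here refl) q , scatter es (h ∘ there) q' , eq

sum-single : ∀ {n} (f : Fin n → ℕ) i → (∀ j → j ≢ i → f j ≡ 0) → sum f ≡ f i
sum-single {suc n} f zero    h = trans (cong (f zero +_) (sum-zero (λ j → h (suc j) (λ ())))) (+-identityʳ _)
sum-single {suc n} f (suc i) h = trans (cong (_+ sum (f ∘ suc)) (h zero (λ ())))
  (sum-single (f ∘ suc) i (λ j j≢i → h (suc j) (λ e → j≢i (suc-injectiveᶠ e))))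

module _ {m k : ℕ} (cls : Fin k → Fin m) (occ : Fin k → ℕ) {P : Fin k → Set} (P? : ∀ e → Dec (P e)) (c : Fin m) where

  private
    weight : Fin k → ℕ
    weight e = if does (P? e) then (if does (cls e ≟ᶠ c) then occ e else 0) else 0

  count-filter : ∀ {n} (f : Fin n → Fin k) → count cls occ (filter P? (tabulate f)) c ≡ sum (λ i → weight (f i))
  count-filter {zero}  f = refl
  count-filter {suc n} f with does (P? (f zero))
  ... | true  = cong ((if does (cls (f zero) ≟ᶠ c) then occ (f zero) else 0) +_) (count-filter (f ∘ suc))
  ... | false = count-filter (f ∘ suc)

  count-unique : ∀ e₀ → P e₀ → cls e₀ ≡ c → (∀ e → P e → cls e ≡ c → e ≡ e₀) → count cls occ (filter P? (allFin k)) c ≡ occ e₀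
  count-unique e₀ pe ce uniq = trans (count-filter (λ e → e)) (trans (sum-single weight e₀ others) here≡)
    where
    here≡ : weight e₀ ≡ occ e₀
    here≡ with P? e₀ | cls e₀ ≟ᶠ c
    ... | yes _ | yes _  = refl
    ... | yes _ | no nc  = ⊥-elim (nc ce)
    ... | no np | _      = ⊥-elim (np pe)
    others : ∀ e → e ≢ e₀ → weight e ≡ 0
    others e ne with P? e | cls e ≟ᶠ c
    ... | yes p | yes q = ⊥-elim (ne (uniq e p q))
    ... | yes _ | no _  = refl
    ... | no _  | _     = refl

module _ {nΣ : ℕ} (S : Schema nΣ) (G : CGraph nΣ) where
  open Schema S
  open CGraph G

  module _ {m : ℕ} (τ : Fin m → Fin nΣ × (Fin nT → Bool)) (cls : Fin nE → Fin m) (Ty : Typing S G) (n : Fin nN)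
           (lab≡ : ∀ e → proj₁ (τ (cls e)) ≡ lab e) where

    profile : Fin m → ℕ
    profile = count cls occur (out S G n)

    private
      source-out : ∀ {e} → e ∈ out S G n → source e ≡ n
      source-out m = proj₂ (∈-filter⁻ (λ e → source e ≟ᶠ n) {xs = allFin nE} m)

    -- Types are compared only on edges of positive multiplicity, since a power with exponent zero
    -- is the empty bag whatever its base. The fused graph has edges of multiplicity zero with
    -- targets of any kind.
    sign→flow : (∀ e → source e ≡ n → 0 < occur e → ∀ t → Ty (target e) t ≡ true → proj₂ (τ (cls e)) t ≡ true) →
                signL S G Ty n ⊆ Flow τ profile
    sign→flow h = gather cls occur (λ c → Pick (proj₁ (τ c)) (proj₂ (τ c))) _ (out S G n) λ {e} m →
      pow-mono-pos (occur e) λ pos p →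
        pick-mono (≡-sym (lab≡ e)) (h e (source-out m) pos) (pick-disj S G (lab e) (Ty (target e)) p)

    flow→sign : (∀ e → source e ≡ n → 0 < occur e → ∀ t → proj₂ (τ (cls e)) t ≡ true → Ty (target e) t ≡ true) →
                Flow τ profile ⊆ signL S G Ty n
    flow→sign h = scatter cls occur (λ c → Pick (proj₁ (τ c)) (proj₂ (τ c))) _ (out S G n) λ {e} m →
      pow-mono-pos (occur e) λ pos p →
        disj-pick S G (lab e) (Ty (target e)) (pick-mono (lab≡ e) (h e (source-out m) pos) p)

  sign-mono : ∀ {Ty Ty'} → (∀ n t → Ty n t ≡ true → Ty' n t ≡ true) → ∀ n → signL S G Ty n ⊆ signL S G Ty' n
  sign-mono {Ty} {Ty'} h n = go (out S G n)
    where
    L : Typing S G → Fin nE → Lang nΣ nT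
    L Ty e = powL (disjL S G (map (lab e ,_) (typesOf S G Ty (target e)))) (occur e)
    go : ∀ es → foldr _⊎L_ emptyBagL (map (L Ty) es) ⊆ foldr _⊎L_ emptyBagL (map (L Ty') es)
    go []       p = p
    go (e ∷ es) (u , v , p , q , eq) = u , v ,
      pow-mono (λ r → disj-pick S G (lab e) (Ty' (target e)) (pick-mono refl (h (target e)) (pick-disj S G (lab e) (Ty (target e)) r))) (occur e) p ,
      go es q , eq

  sign-finite : ∀ Ty n → Finite (signL S G Ty n)
  sign-finite Ty n = go (out S G n)
    where
    disj-finite : ∀ as → Finite (disjL S G as)
    disj-finite []       = none-finite
    disj-finite (s ∷ as) = ∪-finite (single-finite s) (disj-finite as)
    go : ∀ es → Finite (foldr _⊎L_ emptyBagL (map (λ e → powL (disjL S G (map (lab e ,_) (typesOf S G Ty (target e)))) (occur e)) es))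
    go []       = empty-finite
    go (e ∷ es) = ⊎-finite (pow-finite (disj-finite (map (lab e ,_) (typesOf S G Ty (target e)))) (occur e)) (go es)

  Supported : Typing S G → Fin nN → Fin nT → Set
  Supported Ty n t = ∃ λ w → signL S G Ty n w × ⟦ δ t ⟧ w

  supported? : ∀ Ty n t → Dec (Supported Ty n t)
  supported? Ty n t = finite-∃? (sign-finite Ty n) (⟦⟧-ext (δ t)) (⟦⟧-dec (δ t))

  supported-mono : ∀ {Ty Ty'} → (∀ n t → Ty n t ≡ true → Ty' n t ≡ true) → ∀ n t → Supported Ty n t → Supported Ty' n t
  supported-mono {Ty} {Ty'} h n t (w , p , q) = w , sign-mono {Ty} {Ty'} h n p , q

  does-true : ∀ {P : Set} (p : Dec P) → does p ≡ true → P
  does-true (yes p) _ = p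

  stage : ℕ → Typing S G
  stage zero    n t = true
  stage (suc i) n t = does (supported? (stage i) n t)

  stage-decreasing : ∀ i n t → stage (suc i) n t ≡ true → stage i n t ≡ true
  stage-decreasing zero    n t _ = refl
  stage-decreasing (suc i) n t p = dec-true (supported? (stage i) n t)
    (supported-mono {stage (suc i)} {stage i} (stage-decreasing i) n t (does-true (supported? (stage (suc i)) n t) p))

  valid⊆stage : ∀ {Ty} → Valid S G Ty → ∀ i n t → Ty n t ≡ true → stage i n t ≡ true
  valid⊆stage v zero    n t p = refl
  valid⊆stage {Ty} v (suc i) n t p = dec-true (supported? (stage i) n t) (supported-mono {Ty} {stage i} (valid⊆stage v i) n t (v n t p))

  weight : ℕ → ℕ
  weight i = sum (λ n → sum (λ t → bit (stage i n t)))

  Stable : ℕ → Set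
  Stable i = ∀ n t → stage i n t ≡ true → stage (suc i) n t ≡ true

  stable? : ∀ i → Dec (Stable i)
  stable? i = all? (λ n → all? (λ t → (stage i n t Bool.≟ true) →-dec (stage (suc i) n t Bool.≟ true)))

  unstable-drops : ∀ i → ¬ Stable i → weight (suc i) < weight i
  unstable-drops i ¬st with ¬∀⟶∃¬ nN _ (λ n → all? (λ t → (stage i n t Bool.≟ true) →-dec (stage (suc i) n t Bool.≟ true))) ¬st
  ... | n , ¬stₙ with ¬∀⟶∃¬ nT _ (λ t → (stage i n t Bool.≟ true) →-dec (stage (suc i) n t Bool.≟ true)) ¬stₙ
  ... | t , ¬stₜ = sum-mono-< (λ n → sum-mono (bit≤ n)) n (sum-mono-< (bit≤ n) t (drop (stage i n t) (stage (suc i) n t) ¬stₜ))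
    where
    bit-mono : ∀ x y → (y ≡ true → x ≡ true) → bit y ≤ bit x
    bit-mono x true  h = subst (λ z → 1 ≤ bit z) (≡-sym (h refl)) ≤-refl
    bit-mono x false h = z≤n
    bit≤ : ∀ n t → bit (stage (suc i) n t) ≤ bit (stage i n t)
    bit≤ n t = bit-mono (stage i n t) (stage (suc i) n t) (stage-decreasing i n t)
    drop : ∀ x y → ¬ (x ≡ true → y ≡ true) → bit y < bit x
    drop true  true  h = ⊥-elim (h λ e → e)
    drop true  false h = ≤-refl
    drop false y     h = ⊥-elim (h λ ())

  stabilises : ∃ Stable
  stabilises = go 0 (<-wellFounded _)
    where
    go : ∀ i → Acc _<_ (weight i) → ∃ Stable
    go i (wf rec) with stable? i
    ... | yes st = i , st
    ... | no ¬st = go (suc i) (rec (unstable-drops i ¬st))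

  stable-max : ∀ i → Stable i → MaxValid S G (stage i)
  stable-max i st = (λ n t p → does-true (supported? (stage i) n t) (st n t p)) , λ Ty v n t p → valid⊆stage {Ty} v i n t p

  satisfies : ∀ Ty → Valid S G Ty → (∀ n → ∃ λ t → Ty n t ≡ true) → Satisfies S G
  satisfies Ty v typed with stabilises
  ... | i , st = stage i , stable-max i st , λ n → proj₁ (typed n) , valid⊆stage v i n _ (proj₂ (typed n))

  untyped-node : ¬ Satisfies S G → ∃ λ i → ∃ λ n → ∀ t → stage i n t ≡ false
  untyped-node ¬sat with stabilises
  ... | i , st with all? (λ n → any? (λ t → stage i n t Bool.≟ true))
  ... | yes typed = ⊥-elim (¬sat (stage i , stable-max i st , typed))
  ... | no ¬typed with ¬∀⟶∃¬ nN _ (λ n → any? (λ t → stage i n t Bool.≟ true)) ¬typed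
  ... | n , none = i , n , λ t → ¬-not (λ e → none (t , e))

-- Fusion of nodes of the same kind

fin→Bool : Fin 2 → Bool
fin→Bool zero    = false
fin→Bool (suc _) = true

fin→Bool→Fin : ∀ x → fin→Bool (bool→Fin x) ≡ x
fin→Bool→Fin false = refl
fin→Bool→Fin true  = refl

encodeSet : ∀ {k} → (Fin k → Bool) → Fin (2 ^ k)
encodeSet B = funToFin (λ t → bool→Fin (B t))

decodeSet : ∀ {k} → Fin (2 ^ k) → Fin k → Bool
decodeSet i t = fin→Bool (finToFun i t)

decode-encode : ∀ {k} (B : Fin k → Bool) → decodeSet (encodeSet B) ≗ B
decode-encode B t = trans (cong fin→Bool (finToFun-funToFin (λ t → bool→Fin (B t)) t)) (fin→Bool→Fin (B t))

module _ {nΣ : ℕ} (H K : Schema nΣ) where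
  private
    module H = Schema H
    module K = Schema K

  -- A kind is a pair of a set of types of H and a set of types of K.
  Kinds : ℕ
  Kinds = 2 ^ H.nT * 2 ^ K.nT

  kind : (Fin H.nT → Bool) → (Fin K.nT → Bool) → Fin Kinds
  kind A B = combine (encodeSet A) (encodeSet B)

  kindH : Fin Kinds → Fin H.nT → Bool
  kindH κ = decodeSet (proj₁ (remQuot {2 ^ H.nT} (2 ^ K.nT) κ))

  kindK : Fin Kinds → Fin K.nT → Bool
  kindK κ = decodeSet (proj₂ (remQuot {2 ^ H.nT} (2 ^ K.nT) κ))

  kindH-kind : ∀ A B → kindH (kind A B) ≗ A
  kindH-kind A B t = trans (cong (λ p → decodeSet (proj₁ p) t) (remQuot-combine (encodeSet A) (encodeSet B))) (decode-encode A t)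

  kindK-kind : ∀ A B → kindK (kind A B) ≗ B
  kindK-kind A B t = trans (cong (λ p → decodeSet (proj₂ p) t) (remQuot-combine (encodeSet A) (encodeSet B))) (decode-encode B t)

  -- A class is a label together with the kind of the target. Edges of one class offer the same
  -- choices in both schemas, so only their total multiplicity matters, and one edge per source and
  -- class makes a simple graph.
  Classes : ℕ
  Classes = nΣ * Kinds

  classLab : Fin Classes → Fin nΣ
  classLab c = proj₁ (remQuot {nΣ} Kinds c)

  classKind : Fin Classes → Fin Kinds
  classKind c = proj₂ (remQuot {nΣ} Kinds c)

  τH : Fin Classes → Fin nΣ × (Fin H.nT → Bool)
  τH c = classLab c , kindH (classKind c)

  τK : Fin Classes → Fin nΣ × (Fin K.nT → Bool)
  τK c = classLab c , kindK (classKind c)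

  AcceptsHK : Fin H.nT ⊎ Fin K.nT → (Fin Classes → ℕ) → Set
  AcceptsHK = [ (λ t → Accepts (H.δ t) τH) , (λ t → Accepts (K.δ t) τK) ]

  module _ (bnd : ℕ)
    (small : ∀ x → ∃ λ y → (∀ c → y c ≤ bnd) × (∀ c → y c ≤ x c) ×
             (∀ α → AcceptsHK α x → AcceptsHK α y) × (∀ α → AcceptsHK α y → AcceptsHK α x))
    (G : CGraph nΣ) (TyH : Typing H G) (validH : Valid H G TyH) (typedH : ∀ n → ∃ λ t → TyH n t ≡ true)
    (last : ℕ) (n₀ : Fin (CGraph.nN G)) (untyped : ∀ t → stage K G last n₀ t ≡ false) where

    private
      module G = CGraph G

    code : ℕ → Fin G.nN → Fin Kinds
    code j n = kind (TyH n) (stage K G j n)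

    -- For a kind that no node has by stage `l` the condition is vacuous, so that `node` and `birth`
    -- are total. Such a kind imitates `n₀` at stage 0, which is still enough for `H`.
    Earliest : ℕ → Fin Kinds → Set
    Earliest l κ = ∃₂ λ n j → j ≤ l × ∀ j' n' → j' ≤ l → code j' n' ≡ κ → code j n ≡ κ × j ≤ j'

    earliest : ∀ κ → Earliest last κ
    earliest κ = close (search last)
      where
      Found : ℕ → Set
      Found l = ∃₂ λ n j → j ≤ l × code j n ≡ κ × (∀ j' n' → j' ≤ l → code j' n' ≡ κ → j ≤ j')
      Absent : ℕ → Set
      Absent l = ∀ j' n' → j' ≤ l → code j' n' ≢ κ
      search : ∀ l → Found l ⊎ Absent l
      search zero with any? (λ n → code 0 n ≟ᶠ κ)
      ... | yes (n , e) = inj₁ (n , 0 , z≤n , e , λ _ _ _ _ → z≤n)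
      ... | no none     = inj₂ λ { .0 n' z≤n e → none (n' , e) }
      search (suc l) with search l
      ... | inj₁ (n , j , j≤l , e , least) = inj₁ (n , j , ≤-trans j≤l (n≤1+n l) , e , λ j' n' le e' →
        [ (λ lt → least j' n' (≤-pred lt) e') , (λ { refl → ≤-trans j≤l (n≤1+n l) }) ] (m≤n⇒m<n∨m≡n le))
      ... | inj₂ none with any? (λ n → code (suc l) n ≟ᶠ κ)
      ... | yes (n , e) = inj₁ (n , suc l , ≤-refl , e , λ j' n' le e' →
        [ (λ lt → ⊥-elim (none j' n' (≤-pred lt) e')) , (λ { refl → ≤-refl }) ] (m≤n⇒m<n∨m≡n le))
      ... | no none' = inj₂ λ j' n' le e → [ (λ lt → none j' n' (≤-pred lt) e) , (λ { refl → none' (n' , e) }) ] (m≤n⇒m<n∨m≡n le)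
      close : Found last ⊎ Absent last → Earliest last κ
      close (inj₁ (n , j , j≤ , e , least)) = n , j , j≤ , λ j' n' le e' → e , least j' n' le e'
      close (inj₂ none) = n₀ , 0 , z≤n , λ j' n' le e' → ⊥-elim (none j' n' le e')

    node : Fin Kinds → Fin G.nN
    node κ = proj₁ (earliest κ)

    birth : Fin Kinds → ℕ
    birth κ = proj₁ (proj₂ (earliest κ))

    Born : Fin Kinds → Set
    Born κ = code (birth κ) (node κ) ≡ κ

    born : ∀ {κ} j n → j ≤ last → κ ≡ code j n → Born κ × birth κ ≤ j
    born {κ} j n le e = proj₂ (proj₂ (proj₂ (earliest κ))) j n le (≡-sym e)

    -- For a kind born at stage 0 the targets are taken at stage 0 as well. This is harmless for
    -- `K`, as stage 0 contains all types.
    before : Fin Kinds → ℕ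
    before κ = pred (birth κ)

    before≤last : ∀ κ → before κ ≤ last
    before≤last κ = ≤-trans pred[n]≤n (proj₁ (proj₂ (proj₂ (earliest κ))))

    edgeClass : Fin Kinds → Fin G.nE → Fin Classes
    edgeClass κ e = combine (G.lab e) (code (before κ) (G.target e))

    edgeClass-lab : ∀ κ e → classLab (edgeClass κ e) ≡ G.lab e
    edgeClass-lab κ e = cong proj₁ (remQuot-combine (G.lab e) (code (before κ) (G.target e)))

    edgeClass-kind : ∀ κ e → classKind (edgeClass κ e) ≡ code (before κ) (G.target e)
    edgeClass-kind κ e = cong proj₂ (remQuot-combine (G.lab e) (code (before κ) (G.target e)))

    big : Fin Kinds → Fin Classes → ℕ
    big κ = count (edgeClass κ) G.occur (out H G (node κ))

    mult : Fin Kinds → Fin Classes → ℕ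
    mult κ = proj₁ (small (big κ))

    mult≤bnd : ∀ κ c → mult κ c ≤ bnd
    mult≤bnd κ = proj₁ (proj₂ (small (big κ)))

    mult≤big : ∀ κ c → mult κ c ≤ big κ c
    mult≤big κ = proj₁ (proj₂ (proj₂ (small (big κ))))

    fusedSource : Fin (Kinds * Classes) → Fin Kinds
    fusedSource e = proj₁ (remQuot {Kinds} Classes e)

    fusedClass : Fin (Kinds * Classes) → Fin Classes
    fusedClass e = proj₂ (remQuot {Kinds} Classes e)

    -- One node per kind. The edges of a kind imitate those of a node of G that acquires it at the earliest
    -- stage, so that they lead to kinds acquired even earlier.
    fused : CGraph nΣ
    fused = record
      { nN = Kinds ; nE = Kinds * Classes
      ; source = fusedSource ; target = λ e → classKind (fusedClass e) ; lab = λ e → classLab (fusedClass e)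
      ; occur = λ e → mult (fusedSource e) (fusedClass e)
      ; simple = λ e e' p q r → trans (≡-sym (combine-remQuot {Kinds} Classes e)) (trans
          (cong₂ combine p (trans (≡-sym (combine-remQuot {nΣ} Kinds (fusedClass e)))
            (trans (cong₂ combine r q) (combine-remQuot {nΣ} Kinds (fusedClass e')))))
          (combine-remQuot {Kinds} Classes e')) }

    private
      module F = CGraph fused

    fused-profile : ∀ κ → count fusedClass F.occur (out H fused κ) ≗ mult κ
    fused-profile κ c = trans
      (count-unique fusedClass F.occur (λ e → fusedSource e ≟ᶠ κ) c (combine κ c) (cong proj₁ rq) (cong proj₂ rq)
        (λ { e refl refl → ≡-sym (combine-remQuot {Kinds} Classes e) }))
      (cong (λ p → mult (proj₁ p) (proj₂ p)) rq)
      where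
      rq : remQuot {Kinds} Classes (combine κ c) ≡ (κ , c)
      rq = remQuot-combine κ c

    -- By `mult≤big`, a class of positive multiplicity already occurs among the edges of `node κ`,
    -- so its kind is that of an actual node of `G`.
    target-code : ∀ κ e → fusedSource e ≡ κ → 0 < F.occur e → ∃ λ n → F.target e ≡ code (before κ) n
    target-code κ e refl pos with count≢0 (edgeClass κ) G.occur (out H G (node κ)) (fusedClass e) (≤-trans pos (mult≤big κ (fusedClass e)))
    ... | e' , _ , eq = G.target e' , trans (≡-sym (cong classKind eq)) (edgeClass-kind κ e')

    target-born : ∀ κ e → fusedSource e ≡ κ → 0 < F.occur e → Born (F.target e) × birth (F.target e) ≤ before κ
    target-born κ e s pos with target-code κ e s pos
    ... | n , eq = born (before κ) n (before≤last κ) eq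

    kindH-born : ∀ κ → Born κ → ∀ t → kindH κ t ≡ TyH (node κ) t
    kindH-born κ b t = trans (cong (λ κ → kindH κ t) (≡-sym b)) (kindH-kind (TyH (node κ)) (stage K G (birth κ) (node κ)) t)

    kindK-born : ∀ κ → Born κ → ∀ t → kindK κ t ≡ stage K G (birth κ) (node κ) t
    kindK-born κ b t = trans (cong (λ κ → kindK κ t) (≡-sym b)) (kindK-kind (TyH (node κ)) (stage K G (birth κ) (node κ)) t)

    TyF : Typing H fused
    TyF κ t = TyH (node κ) t

    validF : Valid H fused TyF
    validF κ t p = build (validH (node κ) t p)
      where
      τH-sound : ∀ e → G.source e ≡ node κ → 0 < G.occur e → ∀ t → TyH (G.target e) t ≡ true → proj₂ (τH (edgeClass κ e)) t ≡ true
      τH-sound e _ _ t q = trans (cong (λ κ → kindH κ t) (edgeClass-kind κ e)) (trans (kindH-kind (TyH (G.target e)) (stage K G (before κ) (G.target e)) t) q)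
      τH-complete : ∀ e → fusedSource e ≡ κ → 0 < F.occur e → ∀ t → proj₂ (τH (fusedClass e)) t ≡ true → TyF (F.target e) t ≡ true
      τH-complete e s pos t q = trans (≡-sym (kindH-born (F.target e) (proj₁ (target-born κ e s pos)) t)) q
      finish : Accepts (H.δ t) τH (mult κ) → ∃ λ w → signL H fused TyF κ w × ⟦ H.δ t ⟧ w
      finish (w , fw , dw) = w , flow→sign H fused τH fusedClass TyF κ (λ _ → refl) τH-complete
        (flow-cong τH {mult κ} {count fusedClass F.occur (out H fused κ)} (λ c → ≡-sym (fused-profile κ c)) fw) , dw
      build : (∃ λ w → signL H G TyH (node κ) w × ⟦ H.δ t ⟧ w) → ∃ λ w → signL H fused TyF κ w × ⟦ H.δ t ⟧ w
      build (w , sw , dw) = finish (proj₁ (proj₂ (proj₂ (proj₂ (small (big κ))))) (inj₁ t)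
        (w , sign→flow H G τH (edgeClass κ) TyH (node κ) (edgeClass-lab κ) τH-sound sw , dw))

    fused-satisfies : Satisfies H fused
    fused-satisfies = satisfies H fused TyF validF (λ κ → typedH (node κ))

    -- By induction the targets have no types beyond those in their kinds, so a type `t` of `κ` is
    -- accepted by `mult κ`. Then `small`, read from the reduced to the original vector, makes
    -- `big κ` accept it, which puts `t` into the stage of `node κ` at the birth of `κ`. For `H`,
    -- `validF` reads `small` in the other direction.
    valid⊆kindK : ∀ Ty → Valid K fused Ty → ∀ j κ → birth κ ≤ j → Born κ → ∀ t → Ty κ t ≡ true → kindK κ t ≡ true
    valid⊆kindK Ty v j κ le b t p = trans (kindK-born κ b t) (go (birth κ) refl)
      where
      go : ∀ i → birth κ ≡ i → stage K G i (node κ) t ≡ true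
      go zero    _ = refl
      go (suc i) e = dec-true (supported? K G (stage K G i) (node κ) t) (build (v κ t p))
        where
        before≡ : before κ ≡ i
        before≡ = cong pred e
        τK-sound : ∀ e → fusedSource e ≡ κ → 0 < F.occur e → ∀ t → Ty (F.target e) t ≡ true → proj₂ (τK (fusedClass e)) t ≡ true
        τK-sound e' s pos t q with target-born κ e' s pos
        ... | b' , le' = earlier j (subst (_≤ j) e le)
          where
          earlier : ∀ j → suc i ≤ j → kindK (F.target e') t ≡ true
          earlier (suc j') (s≤s i≤j') = valid⊆kindK Ty v j' (F.target e') (≤-trans le' (≤-trans (≤-reflexive before≡) i≤j')) b' t q
        τK-complete : ∀ e → G.source e ≡ node κ → 0 < G.occur e → ∀ t → proj₂ (τK (edgeClass κ e)) t ≡ true → stage K G i (G.target e) t ≡ true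
        τK-complete e' _ _ t q = trans (cong (λ i → stage K G i (G.target e') t) (≡-sym before≡))
          (trans (≡-sym (kindK-kind (TyH (G.target e')) (stage K G (before κ) (G.target e')) t))
            (trans (cong (λ κ → kindK κ t) (≡-sym (edgeClass-kind κ e'))) q))
        finish : Accepts (K.δ t) τK (big κ) → Supported K G (stage K G i) (node κ) t
        finish (w , fw , dw) = w , flow→sign K G τK (edgeClass κ) (stage K G i) (node κ) (edgeClass-lab κ) τK-complete fw , dw
        build : (∃ λ w → signL K fused Ty κ w × ⟦ K.δ t ⟧ w) → Supported K G (stage K G i) (node κ) t
        build (w , sw , dw) = finish (proj₂ (proj₂ (proj₂ (proj₂ (small (big κ))))) (inj₂ t)
          (w , flow-cong τK {count fusedClass F.occur (out H fused κ)} {mult κ} (fused-profile κ)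
                 (sign→flow K fused τK fusedClass Ty κ (λ _ → refl) τK-sound sw) , dw))

    fused-violates : ¬ Satisfies K fused
    fused-violates (Ty , (v , _) , typed) with typed (code last n₀) | born last n₀ ≤-refl refl
    ... | t , p | b , le = true≢false (trans (≡-sym (valid⊆kindK Ty v last (code last n₀) le b t p))
                             (trans (kindK-kind (TyH n₀) (stage K G last n₀) t) (untyped t)))
      where
      true≢false : true ≢ false
      true≢false ()

    fusion : ∃ λ F → Satisfies H F × ¬ Satisfies K F × CGraph.nN F ≡ Kinds × CGraph.nE F ≡ Kinds * Classes × (∀ e → CGraph.occur F e ≤ bnd)
    fusion = fused , fused-satisfies , fused-violates , refl , refl , λ e → mult≤bnd (fusedSource e) (fusedClass e)

-- Doubly exponential bounds

addPoly : List ℕ → List ℕ → List ℕ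
addPoly []      q       = q
addPoly (c ∷ p) []      = c ∷ p
addPoly (c ∷ p) (d ∷ q) = c + d ∷ addPoly p q

mulPoly : List ℕ → List ℕ → List ℕ
mulPoly []      q = []
mulPoly (c ∷ p) q = addPoly (map (c *_) q) (0 ∷ mulPoly p q)

eval-addPoly : ∀ p q x → evalPoly (addPoly p q) x ≡ evalPoly p x + evalPoly q x
eval-addPoly []      q       x = refl
eval-addPoly (c ∷ p) []      x = ≡-sym (+-identityʳ _)
eval-addPoly (c ∷ p) (d ∷ q) x = trans (cong (λ e → c + d + x * e) (eval-addPoly p q x)) (lem c d x (evalPoly p x) (evalPoly q x))
  where
  lem : ∀ c d x e f → c + d + x * (e + f) ≡ (c + x * e) + (d + x * f)
  lem = solve-∀

eval-scalePoly : ∀ c q x → evalPoly (map (c *_) q) x ≡ c * evalPoly q x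
eval-scalePoly c []      x = ≡-sym (*-zeroʳ c)
eval-scalePoly c (d ∷ q) x = trans (cong (λ e → c * d + x * e) (eval-scalePoly c q x)) (lem c d x (evalPoly q x))
  where
  lem : ∀ c d x e → c * d + x * (c * e) ≡ c * (d + x * e)
  lem = solve-∀

eval-mulPoly : ∀ p q x → evalPoly (mulPoly p q) x ≡ evalPoly p x * evalPoly q x
eval-mulPoly []      q x = refl
eval-mulPoly (c ∷ p) q x = trans (eval-addPoly (map (c *_) q) (0 ∷ mulPoly p q) x)
  (trans (cong₂ (λ e f → e + x * f) (eval-scalePoly c q x) (eval-mulPoly p q x)) (lem c x (evalPoly p x) (evalPoly q x)))
  where
  lem : ∀ c x e f → c * f + x * (e * f) ≡ (c + x * e) * f
  lem = solve-∀

Poly : (ℕ → ℕ) → Set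
Poly f = ∃ λ p → ∀ s → f s ≤ evalPoly p s

poly-const : ∀ k → Poly (λ _ → k)
poly-const k = (k ∷ []) , λ s → m≤m+n k _

poly-id : Poly (λ s → s)
poly-id = (0 ∷ 1 ∷ []) , λ s → ≤-reflexive (≡-sym (trans (cong (s *_) (cong (1 +_) (*-zeroʳ s))) (*-identityʳ s)))

poly-+ : ∀ {f g} → Poly f → Poly g → Poly (λ s → f s + g s)
poly-+ (p , h) (q , k) = addPoly p q , λ s → ≤-trans (+-mono-≤ (h s) (k s)) (≤-reflexive (≡-sym (eval-addPoly p q s)))

poly-* : ∀ {f g} → Poly f → Poly g → Poly (λ s → f s * g s)
poly-* (p , h) (q , k) = mulPoly p q , λ s → ≤-trans (*-mono-≤ (h s) (k s)) (≤-reflexive (≡-sym (eval-mulPoly p q s)))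

-- Made to be iterated: `Exp Poly` and `Exp (Exp Poly)` are the singly and doubly exponential
-- functions, and the closure properties of a level follow from those of the level below, which
-- governs the exponents.
Exp : ((ℕ → ℕ) → Set) → (ℕ → ℕ) → Set
Exp 𝒫 f = ∃ λ g → 𝒫 g × (∀ s → f s ≤ 2 ^ g s)

module _ {𝒫 : (ℕ → ℕ) → Set} where

  exp-2^ : ∀ {f} → 𝒫 f → Exp 𝒫 (λ s → 2 ^ f s)
  exp-2^ {f} p = f , p , λ s → ≤-refl

  exp-lift : ∀ {f} → 𝒫 f → Exp 𝒫 f
  exp-lift {f} p = f , p , λ s → <⇒≤ (n<2^n (f s))

  module _ (plus : ∀ {f g} → 𝒫 f → 𝒫 g → 𝒫 (λ s → f s + g s)) where

    exp-* : ∀ {f g} → Exp 𝒫 f → Exp 𝒫 g → Exp 𝒫 (λ s → f s * g s)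
    exp-* (f' , p , h) (g' , q , k) = (λ s → f' s + g' s) , plus p q , λ s →
      ≤-trans (*-mono-≤ (h s) (k s)) (≤-reflexive (≡-sym (^-distribˡ-+-* 2 (f' s) (g' s))))

    exp-+ : 𝒫 (λ _ → 1) → ∀ {f g} → Exp 𝒫 f → Exp 𝒫 g → Exp 𝒫 (λ s → f s + g s)
    exp-+ one (f' , p , h) (g' , q , k) = (λ s → 1 + (f' s + g' s)) , plus one (plus p q) , λ s →
      ≤-trans (+-mono-≤ (h s) (k s)) (2^+2^≤ (f' s) (g' s))

  exp-^ : (∀ {f g} → 𝒫 f → 𝒫 g → 𝒫 (λ s → f s * g s)) → ∀ {f g} → Exp 𝒫 f → 𝒫 g → Exp 𝒫 (λ s → f s ^ g s)
  exp-^ times {f} {g} (f' , p , h) q = (λ s → f' s * g s) , times p q , λ s →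
    ≤-trans (^-monoˡ-≤ (g s) (h s)) (≤-reflexive (^-*-assoc 2 (f' s) (g s)))

square-∥ : ∀ m n {x y} → x ≤ 2 ^ (m * m) → y ≤ 2 ^ (n * n) → x + y ≤ 2 ^ (suc (m + n) * suc (m + n))
square-∥ m n p q = ≤-trans (+-mono-≤ p q) (≤-trans (2^+2^≤ (m * m) (n * n))
  (2^-mono (≤-trans (m≤m+n (suc (m * m + n * n)) _) (≤-reflexive (lem m n)))))
  where
  lem : ∀ m n → suc (m * m + n * n) + (2 * m + 2 * n + 2 * (m * n)) ≡ suc (m + n) * suc (m + n)
  lem = solve-∀

square-^ : ∀ i m {x} → x ≤ 2 ^ (m * m) → 2 ^ (i + m) * x ≤ 2 ^ (suc (m + i) * suc (m + i))
square-^ i m p = ≤-trans (*-monoʳ-≤ (2 ^ (i + m)) p) (≤-trans (≤-reflexive (≡-sym (^-distribˡ-+-* 2 (i + m) (m * m))))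
  (2^-mono (≤-trans (m≤m+n (i + m + m * m) _) (≤-reflexive (lem i m)))))
  where
  lem : ∀ i m → i + m + m * m + (1 + i * i + m + i + 2 * (m * i)) ≡ suc (m + i) * suc (m + i)
  lem = solve-∀

-- An iteration multiplies the bound by `cap`, whose exponent is linear in the size, and iterations
-- nest at most as deep as the size; hence the square.
β≤ : ∀ {a b} (E : RBE a b) → β E ≤ 2 ^ (sizeE E * sizeE E)
β≤ ε        = z≤n
β≤ (sym _)  = s≤s z≤n
β≤ (E ∣ F)  = square-∥ (sizeE E) (sizeE F) (β≤ E) (β≤ F)
β≤ (E ∥ F)  = square-∥ (sizeE E) (sizeE F) (β≤ E) (β≤ F)
β≤ (E ^ᴵ I) = square-^ (sizeI I) (sizeE E) (β≤ E)

module _ (nΣ : ℕ) where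

  -- Bounds, in terms of the size s of the two schemas, on the entries of basic bags, on the remainders of
  -- periods under halving, on the number of classes of edges, and on the number of states of the recognizer.
  βBound starBound CBound classBound stateBound sizeBound : ℕ → ℕ
  βBound s     = 2 ^ (s * s)
  starBound s  = suc (suc (βBound s) ^ (nΣ * s)) * βBound s
  CBound s     = s * starBound s + βBound s
  classBound s = nΣ * 2 ^ s
  stateBound s = (s + s) * (suc (classBound s * suc s) ^ (nΣ * s) * (suc (CBound s) ^ (nΣ * s) * 2 ^ s))
  sizeBound s  = 2 ^ s + 2 ^ s * classBound s * (2 + (s + 2 ^ stateBound s))

  sizeBound-doubly-exponential : Exp (Exp Poly) sizeBound
  sizeBound-doubly-exponential =
    plus₃ (exp-2^ id₂) (times₃ (times₃ (exp-2^ id₂) (exp-lift class₂)) (plus₃ (exp-lift (const₂ 2)) (plus₃ (exp-lift id₂) (exp-2^ state₂))))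
    where
    plus₂ : ∀ {f g} → Exp Poly f → Exp Poly g → Exp Poly (λ s → f s + g s)
    plus₂ = exp-+ poly-+ (poly-const 1)
    times₂ : ∀ {f g} → Exp Poly f → Exp Poly g → Exp Poly (λ s → f s * g s)
    times₂ = exp-* poly-+
    pow₂ : ∀ {f g} → Exp Poly f → Poly g → Exp Poly (λ s → f s ^ g s)
    pow₂ = exp-^ poly-*
    const₂ : ∀ k → Exp Poly (λ _ → k)
    const₂ k = exp-lift (poly-const k)
    suc₂ : ∀ {f} → Exp Poly f → Exp Poly (λ s → suc (f s))
    suc₂ = plus₂ (const₂ 1)
    id₂ : Exp Poly (λ s → s)
    id₂ = exp-lift poly-id
    plus₃ : ∀ {f g} → Exp (Exp Poly) f → Exp (Exp Poly) g → Exp (Exp Poly) (λ s → f s + g s)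
    plus₃ = exp-+ plus₂ (const₂ 1)
    times₃ : ∀ {f g} → Exp (Exp Poly) f → Exp (Exp Poly) g → Exp (Exp Poly) (λ s → f s * g s)
    times₃ = exp-* plus₂
    syms : Poly (λ s → nΣ * s)
    syms = poly-* (poly-const nΣ) poly-id
    β₂ : Exp Poly βBound
    β₂ = exp-2^ (poly-* poly-id poly-id)
    C₂ : Exp Poly CBound
    C₂ = plus₂ (times₂ id₂ (times₂ (suc₂ (pow₂ (suc₂ β₂) syms)) β₂)) β₂
    class₂ : Exp Poly classBound
    class₂ = times₂ (const₂ nΣ) (exp-2^ poly-id)
    state₂ : Exp Poly stateBound
    state₂ = times₂ (plus₂ id₂ id₂) (times₂ (pow₂ (suc₂ (times₂ class₂ (suc₂ id₂))) syms)
      (times₂ (pow₂ (suc₂ C₂) syms) (exp-2^ poly-id)))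

  module _ {b s : ℕ} (b≤s : b ≤ s) where

    β≤βBound : ∀ (E : RBE nΣ b) → sizeE E ≤ s → β E ≤ βBound s
    β≤βBound E le = ≤-trans (β≤ E) (2^-mono (*-mono-≤ le le))

    ^-mono : ∀ {m m' n n'} → m ≤ m' → n ≤ n' → suc m ^ n ≤ suc m' ^ n'
    ^-mono {m' = m'} {n} p q = ≤-trans (^-monoˡ-≤ n (s≤s p)) (^-monoʳ-≤ (suc m') q)

    linear-∥ : ∀ m n {x y} k → x ≤ m * k → y ≤ n * k → x + y ≤ suc (m + n) * k
    linear-∥ m n k p q = ≤-trans (+-mono-≤ p q) (≤-trans (≤-reflexive (≡-sym (*-distribʳ-+ k m n))) (m≤n+m _ k))

    γ≤ : ∀ (E : RBE nΣ b) → sizeE E ≤ s → γ E ≤ sizeE E * starBound s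
    γ≤ ε        le = z≤n
    γ≤ (sym _)  le = z≤n
    γ≤ (E ∣ F)  le = linear-∥ (sizeE E) (sizeE F) (starBound s)
      (γ≤ E (≤-trans (m≤m+n _ _) (<⇒≤ le))) (γ≤ F (≤-trans (m≤n+m _ (sizeE E)) (<⇒≤ le)))
    γ≤ (E ∥ F)  le = linear-∥ (sizeE E) (sizeE F) (starBound s)
      (γ≤ E (≤-trans (m≤m+n _ _) (<⇒≤ le))) (γ≤ F (≤-trans (m≤n+m _ (sizeE E)) (<⇒≤ le)))
    γ≤ (E ^ᴵ I) le = +-mono-≤
      (*-mono-≤ (s≤s (^-mono (β≤βBound E le') (*-monoʳ-≤ nΣ b≤s))) (β≤βBound E le'))
      (≤-trans (γ≤ E le') (*-monoˡ-≤ (starBound s) (m≤m+n (sizeE E) (sizeI I))))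
      where
      le' : sizeE E ≤ s
      le' = ≤-trans (m≤m+n _ _) (<⇒≤ le)

    γ≤CBound : ∀ (E : RBE nΣ b) → sizeE E ≤ s → γ E ≤ CBound s
    γ≤CBound E le = ≤-trans (γ≤ E le) (≤-trans (*-monoˡ-≤ (starBound s) le) (m≤m+n _ _))

    β≤CBound : ∀ (E : RBE nΣ b) → sizeE E ≤ s → β E ≤ CBound s
    β≤CBound E le = ≤-trans (β≤βBound E le) (m≤n+m _ _)

    states : ℕ → ℕ
    states m = suc (m * suc s) ^ (nΣ * b) * (suc (CBound s) ^ (nΣ * b) * 2 ^ s)

    -- The digit parameter is `s`, which bounds the number of types in each schema: `pow-halve`
    -- needs digits of that order, and `recognizer-⊎` needs the recognizers for `H` and `K` to read
    -- the same digits.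
    schema-recognizer : ∀ {m k} (τ : Fin m → Fin nΣ × (Fin b → Bool)) (δ : Fin k → RBE nΣ b) → (∀ t → sizeE (δ t) ≤ s) →
                        Recognizer s (λ t → Accepts (δ t) τ) (k * states m)
    schema-recognizer τ δ h = recognizer-family λ t →
      rbe-recognizer τ (δ t) s b≤s (CBound s) (γ≤CBound (δ t) (h t)) (β≤CBound (δ t) (h t)) (h t)

    states≤ : ∀ {k m} → k ≤ s → m ≤ classBound s →
              k * states m ≤ s * (suc (classBound s * suc s) ^ (nΣ * s) * (suc (CBound s) ^ (nΣ * s) * 2 ^ s))
    states≤ p q = *-mono-≤ p (*-mono-≤ (^-mono (*-monoˡ-≤ (suc s) q) (*-monoʳ-≤ nΣ b≤s))
      (*-monoˡ-≤ (2 ^ s) (^-monoʳ-≤ (suc (CBound s)) (*-monoʳ-≤ nΣ b≤s))))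

-- Size of the counterexample

sum-list-bound : ∀ {A : Set} (f : A → ℕ) k → (∀ x → f x ≤ k) → ∀ xs → List-sum (map f xs) ≤ length xs * k
sum-list-bound f k h []       = z≤n
sum-list-bound f k h (x ∷ xs) = +-mono-≤ (h x) (sum-list-bound f k h xs)

∈≤sum-list : ∀ {A : Set} (f : A → ℕ) {x xs} → x ∈ xs → f x ≤ List-sum (map f xs)
∈≤sum-list f (here refl)    = m≤m+n _ _
∈≤sum-list f (there {x} m)  = ≤-trans (∈≤sum-list f m) (m≤n+m _ (f x))

types≤size : ∀ {nΣ} (S : Schema nΣ) → Schema.nT S ≤ sizeS S
types≤size S = m≤m+n _ _

rbe≤size : ∀ {nΣ} (S : Schema nΣ) t → sizeE (Schema.δ S t) ≤ sizeS S
rbe≤size S t = ≤-trans (∈≤sum-list (λ t → sizeE (Schema.δ S t)) (∈-allFin t)) (m≤n+m _ _)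

pumpBound≤ : ∀ {m D n k} {A : Set} {acc : A → (Fin m → ℕ) → Set} (R : Recognizer D acc n) → n ≤ k → pumpBound R ≤ 2 ^ (D + 2 ^ k)
pumpBound≤ {D = D} {n} {k} R le = ≤-trans (*-mono-≤ (n<2^n D) (2^-mono (2^-mono le))) (≤-reflexive (≡-sym (^-distribˡ-+-* 2 D (2 ^ k))))

sizeG≤ : ∀ {nΣ} (F : CGraph nΣ) {i j} k → CGraph.nN F ≤ i → CGraph.nE F ≤ j → (∀ e → CGraph.occur F e ≤ 2 ^ k) →
         sizeG F ≤ i + j * (2 + k)
sizeG≤ F {i} {j} k nN≤ nE≤ occur≤ = +-mono-≤ nN≤ (begin
  List-sum (map (λ e → suc (bits (CGraph.occur F e))) (allFin (CGraph.nE F)))  ≤⟨ sum-list-bound _ (2 + k) bits≤ (allFin (CGraph.nE F)) ⟩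
  length (allFin (CGraph.nE F)) * (2 + k)  ≡⟨ cong (_* (2 + k)) (length-tabulate {n = CGraph.nE F} (λ e → e)) ⟩
  CGraph.nE F * (2 + k)                    ≤⟨ *-monoˡ-≤ (2 + k) nE≤ ⟩
  j * (2 + k)                              ∎)
  where
  open ≤-Reasoning
  bits≤ : ∀ e → suc (bits (CGraph.occur F e)) ≤ 2 + k
  bits≤ e = s≤s (s≤s (≤-trans (⌊log₂⌋-mono-≤ (occur≤ e)) (≤-reflexive (⌊log₂[2^n]⌋≡n k))))

module _ {nΣ : ℕ} (H K : Schema nΣ) where
  private
    s = sizeS H + sizeS K
    module H = Schema H
    module K = Schema K
    H≤s : sizeS H ≤ s
    H≤s = m≤m+n (sizeS H) (sizeS K)
    K≤s : sizeS K ≤ s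
    K≤s = m≤n+m (sizeS K) (sizeS H)
    nH≤s : H.nT ≤ s
    nH≤s = ≤-trans (types≤size H) H≤s
    nK≤s : K.nT ≤ s
    nK≤s = ≤-trans (types≤size K) K≤s

  kinds≤ : Kinds H K ≤ 2 ^ s
  kinds≤ = ≤-trans (≤-reflexive (≡-sym (^-distribˡ-+-* 2 H.nT K.nT))) (2^-mono (+-mono-≤ (types≤size H) (types≤size K)))

  classes≤ : Classes H K ≤ classBound nΣ s
  classes≤ = *-monoʳ-≤ nΣ kinds≤

  schemas-recognizer : Recognizer s (AcceptsHK H K)
    (H.nT * states nΣ nH≤s (Classes H K) + K.nT * states nΣ nK≤s (Classes H K))
  schemas-recognizer = recognizer-⊎
    (schema-recognizer nΣ nH≤s (τH H K) H.δ (λ t → ≤-trans (rbe≤size H t) H≤s))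
    (schema-recognizer nΣ nK≤s (τK H K) K.δ (λ t → ≤-trans (rbe≤size K t) K≤s))

  multBound : ℕ
  multBound = pumpBound schemas-recognizer

  small-profile : ∀ x → ∃ λ y → (∀ c → y c ≤ multBound) × (∀ c → y c ≤ x c) ×
                  (∀ α → AcceptsHK H K α x → AcceptsHK H K α y) × (∀ α → AcceptsHK H K α y → AcceptsHK H K α x)
  small-profile = shrink schemas-recognizer
    (λ P? → map′ (λ { (p , q) → λ { (inj₁ t) → p t ; (inj₂ t) → q t } }) (λ h → h ∘ inj₁ , h ∘ inj₂)
              (all? (P? ∘ inj₁) ×-dec all? (P? ∘ inj₂)))
    (λ { (inj₁ t) → accepts-ext (H.δ t) (τH H K) ; (inj₂ t) → accepts-ext (K.δ t) (τK H K) })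
    (λ { (inj₁ t) → accepts-dec (H.δ t) (τH H K) ; (inj₂ t) → accepts-dec (K.δ t) (τK H K) })

  stateCount≤ : H.nT * states nΣ nH≤s (Classes H K) + K.nT * states nΣ nK≤s (Classes H K) ≤ stateBound nΣ s
  stateCount≤ = ≤-trans (+-mono-≤ (states≤ nΣ nH≤s nH≤s classes≤) (states≤ nΣ nK≤s nK≤s classes≤))
    (≤-reflexive (≡-sym (*-distribʳ-+ _ s s)))

  multBound≤ : multBound ≤ 2 ^ (s + 2 ^ stateBound nΣ s)
  multBound≤ = pumpBound≤ schemas-recognizer stateCount≤

  small-counterexample : (G : CGraph nΣ) → Satisfies H G → ¬ Satisfies K G →
                         ∃ λ F → Satisfies H F × ¬ Satisfies K F × sizeG F ≤ sizeBound nΣ s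
  small-counterexample G (TyH , (validH , _) , typedH) G∉K =
    measure (fusion H K multBound small-profile G TyH validH typedH (proj₁ bare) (proj₁ (proj₂ bare)) (proj₂ (proj₂ bare)))
    where
    bare = untyped-node K G G∉K
    measure : (∃ λ F → Satisfies H F × ¬ Satisfies K F × CGraph.nN F ≡ Kinds H K ×
                CGraph.nE F ≡ Kinds H K * Classes H K × (∀ e → CGraph.occur F e ≤ multBound)) →
              ∃ λ F → Satisfies H F × ¬ Satisfies K F × sizeG F ≤ sizeBound nΣ s
    measure (F , sat , unsat , nN≡ , nE≡ , occur≤) = F , sat , unsat ,
      sizeG≤ F (s + 2 ^ stateBound nΣ s) (≤-trans (≤-reflexive nN≡) kinds≤)
        (≤-trans (≤-reflexive nE≡) (*-mono-≤ kinds≤ classes≤)) (λ e → ≤-trans (occur≤ e) multBound≤)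

weaken-size : ∀ {nΣ} {H K : Schema nΣ} {k l} → k ≤ l →
              (∃ λ F → Satisfies H F × ¬ Satisfies K F × sizeG F ≤ k) → ∃ λ F → Satisfies H F × ¬ Satisfies K F × sizeG F ≤ l
weaken-size k≤l (F , sat , unsat , size≤) = F , sat , unsat , ≤-trans size≤ k≤l

theorem7 : (nΣ : ℕ) → Σ (List ℕ) λ p →
    (H K : Schema nΣ) →
    Σ (SGraph nΣ) (λ G → G ∈L H × ¬ (G ∈L K)) →
    Σ (CGraph nΣ) λ F →
    Satisfies H F × ¬ Satisfies K F ×
    sizeG F ≤ 2 ^ (2 ^ evalPoly p (sizeS H + sizeS K))
theorem7 nΣ = conclude (sizeBound-doubly-exponential nΣ)
  where
  conclude : Exp (Exp Poly) (sizeBound nΣ) → Σ (List ℕ) λ p → (H K : Schema nΣ) → Σ (SGraph nΣ) (λ G → G ∈L H × ¬ (G ∈L K)) →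
             Σ (CGraph nΣ) λ F → Satisfies H F × ¬ Satisfies K F × sizeG F ≤ 2 ^ (2 ^ evalPoly p (sizeS H + sizeS K))
  conclude (f , (g , (p , g≤p) , f≤2^g) , size≤2^f) = p , λ { H K (G , G∈H , G∉K) →
    weaken-size {H = H} {K} (bound (sizeS H + sizeS K)) (small-counterexample H K (toCGraph G) G∈H G∉K) }
    where
    bound : ∀ s → sizeBound nΣ s ≤ 2 ^ (2 ^ evalPoly p s)
    bound s = ≤-trans (size≤2^f s) (2^-mono (≤-trans (f≤2^g s) (2^-mono (g≤p s))))
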